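{- Let $A \subseteq \omega$, and let $\mathbb{P} = (P,\leq,V)$ be a notion of forcing such that the product notion $\mathbb{C} \times \mathbb{P}$ is $1$-decidable in $A$. Then there exist an $A$-computable perfect tree $T \subseteq 2^{<\omega}$ and an $A$-computable class $\mathcal{C}$ of dense subsets of $P$ such that for all $S \in [T]$ and all $G \subseteq \omega$, if $G$ is $\mathcal{C}$-generic for $\mathbb{P}$ then $S \oplus G \not\geq_T A$.
   Context: A notion of forcing is a triple $\mathbb{P} = (P,\leq,V)$ where $P$ is an infinite subset of $\omega$, $\leq$ is a partial order on $P$, and $V : P \to 2^{<\omega}$ (the valuation) is monotone from $(P,\leq)$ to $(2^{<\omega},\succeq)$ (i.e., $q \leq p$ implies $V(q) \succeq V(p)$), such that for each $n$ the set $\{p \in P : |V(p)| \geq n\}$ is dense in $(P,\leq)$. $\mathbb{P}$ is $A$-computable if $P$, $\leq$ and $V$ are $A$-computable. A set $D \subseteq P$ is dense if every $p \in P$ has some $q \leq p$ in $D$. An $A$-computable class of subsets of $P$ means a sequence $\{D_e\}_{e\in\omega}$ of subsets of $P$ that is uniformly $A$-computable. For a filter $F$ on $(P,\leq)$ (nonempty, upward closed, any two members have a common extension in $F$), $|V(F)| = \sup_{p \in F}|V(p)|$, and $V(F)$ denotes the union of the compatible strings $V(p)$, $p \in F$. For a set $\mathcal{C}$ of subsets of $P$, a filter $F$ is $\mathcal{C}$-generic for $\mathbb{P}$ if $|V(F)| = \infty$ and for every $C \in \mathcal{C}$, either $F \cap C \neq \emptyset$ or $F$ contains some $p$ such that no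 $q \leq p$ lies in $C$; a set $G \subseteq \omega$ is $\mathcal{C}$-generic for $\mathbb{P}$ if $G = V(F)$ for some $\mathcal{C}$-generic filter $F$. Forcing language: the language of arithmetic augmented by a set constant $\dot G$. The forcing relation $p \Vdash_{\mathbb{P}} \varphi$ is defined recursively: for atomic $\varphi$, $p \Vdash \varphi$ if $\varphi$ is a true atomic sentence of arithmetic, or $\varphi$ is $\dot n \in \dot G$ with $n < |V(p)|$ and $V(p)(n)=1$, or $\varphi$ is $\dot n \notin \dot G$ with $n < |V(p)|$ and $V(p)(n) = 0$; $p \Vdash \varphi \wedge \psi$ iff $p \Vdash \varphi$ and $p \Vdash \psi$; $p \Vdash \exists x\,\varphi(x)$ iff $p \Vdash \varphi(\dot n)$ for some $n$; $p \Vdash \neg\varphi$ iff no $q \leq p$ forces $\varphi$. $\mathbb{P}$ is $1$-decidable in $A$ if $\mathbb{P}$ is $A$-computable and, for a fixed effective enumeration $\{\varphi_i\}$ of the $\Sigma^0_1$ sentences of the forcing language, there is an $A$-computable $f : P \times \omega \to P \times \{0,1\}$ such that whenever $f(p,i) = (q,t)$ we have $q \leq p$, and $q \Vdash \varphi_i$ if $t = 1$, while $q \Vdash \neg\varphi_i$ if $t = 0$. $\mathbb{C}$ is Cohen forcing (binary strings ordered by extension, valuation the identity). The product $\mathbb{C} \times \mathbb{P}$ has as conditions the pairs $(\sigma,p) \in 2^{<\omega} \times P$ with $|\sigma| = |V(p)|$ (coded as natural numbers), ordered componentwise ($(\sigma',p') \leq (\sigma,p)$ iff $\sigma' \succeq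 \sigma$ and $p' \leq p$), with valuation $V_\times(\sigma,p) = \sigma \oplus V(p)$ (the interleaving of the two strings). A tree $T\subseteq 2^{<\omega}$ is perfect if every node has two incomparable extensions in $T$; $[T]$ is its set of infinite paths; $S \oplus G = \{2n : n\in S\}\cup\{2n+1 : n \in G\}$. -}

module Defs where

open import Data.Nat using (ℕ; zero; suc; _≤_; _<_; _+_; _*_)
open import Data.Bool using (Bool; true; false; _∧_)
open import Data.Fin using (Fin)
import Data.Fin as Fin
open import Data.Vec using (Vec; []; _∷_; lookup)
open import Data.List using (List; []; _∷_; _++_; length)
open import Data.Maybe using (Maybe; just; nothing)
import Data.Maybe as Maybe
open import Data.Product using (Σ; _×_; _,_)
open import Data.Sum using (_⊎_)
open import Relation.Binary.PropositionalEquality using (_≡_)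
open import Relation.Nullary using (¬_)

-- Subsets of ω are represented by characteristic functions.
b2n : Bool → ℕ
b2n true  = 1
b2n false = 0

Str : Set
Str = List Bool

-- bijective base-2 coding of binary strings
encStr : Str → ℕ
encStr []          = 0
encStr (false ∷ s) = 1 + 2 * encStr s
encStr (true ∷ s)  = 2 + 2 * encStr s

incStr : Str → Str
incStr []          = false ∷ []
incStr (false ∷ s) = true ∷ s
incStr (true ∷ s)  = false ∷ incStr s

decStr : ℕ → Str
decStr zero    = []
decStr (suc n) = incStr (decStr n)

-- Cantor-style enumeration of ℕ × ℕ (a bijection ℕ → ℕ × ℕ)
nextPair : ℕ × ℕ → ℕ × ℕ
nextPair (a , zero)  = (0 , suc a)
nextPair (a , suc b) = (suc a , b)

unpair : ℕ → ℕ × ℕ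
unpair zero    = (0 , 0)
unpair (suc n) = nextPair (unpair n)

_≼_ : Str → Str → Set
σ ≼ τ = Σ Str λ ρ → σ ++ ρ ≡ τ

isPrefixᵇ : Str → Str → Bool
isPrefixᵇ [] _ = true
isPrefixᵇ (_ ∷ _) [] = false
isPrefixᵇ (true ∷ s) (true ∷ t) = isPrefixᵇ s t
isPrefixᵇ (false ∷ s) (false ∷ t) = isPrefixᵇ s t
isPrefixᵇ (true ∷ s) (false ∷ t) = false
isPrefixᵇ (false ∷ s) (true ∷ t) = false

_==ᵇ_ : ℕ → ℕ → Bool
zero ==ᵇ zero = true
zero ==ᵇ suc _ = false
suc _ ==ᵇ zero = false
suc m ==ᵇ suc n = m ==ᵇ n

bitAt : Str → ℕ → Maybe Bool
bitAt [] _ = nothing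
bitAt (b ∷ s) zero = just b
bitAt (b ∷ s) (suc n) = bitAt s n

-- interleaving σ ⊕ τ of strings of equal length
interleave : Str → Str → Str
interleave (a ∷ s) (b ∷ t) = a ∷ b ∷ interleave s t
interleave _ _ = []

_⊕_ : (ℕ → Bool) → (ℕ → Bool) → ℕ → Bool
(S ⊕ G) zero = S 0
(S ⊕ G) (suc zero) = G 0
(S ⊕ G) (suc (suc n)) = ((λ m → S (suc m)) ⊕ (λ m → G (suc m))) n

initSeg : (ℕ → Bool) → ℕ → Str
initSeg S zero = []
initSeg S (suc n) = S 0 ∷ initSeg (λ m → S (suc m)) n

data PR : ℕ → Set where
  zer  : ∀ {k} → PR k
  succ : PR 1
  proj : ∀ {k} → Fin k → PR k
  orc  : PR 1
  comp : ∀ {k m} → PR m → Vec (PR k) m → PR k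
  prec : ∀ {k} → PR k → PR (suc (suc k)) → PR (suc k)
  mu   : ∀ {k} → PR (suc k) → PR k

mutual
  data Eval (A : ℕ → Bool) : ∀ {k} → PR k → Vec ℕ k → ℕ → Set where
    ev-zer  : ∀ {k} {xs : Vec ℕ k} → Eval A zer xs 0
    ev-succ : ∀ {x} → Eval A succ (x ∷ []) (suc x)
    ev-proj : ∀ {k} {i : Fin k} {xs} → Eval A (proj i) xs (lookup xs i)
    ev-orc  : ∀ {x} → Eval A orc (x ∷ []) (b2n (A x))
    ev-comp : ∀ {k m} {g : PR m} {hs : Vec (PR k) m} {xs ys y} →
              EvalAll A hs xs ys → Eval A g ys y → Eval A (comp g hs) xs y
    ev-prec0 : ∀ {k} {g : PR k} {h} {xs y} →
              Eval A g xs y → Eval A (prec g h) (0 ∷ xs) y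
    ev-precS : ∀ {k} {g : PR k} {h} {n xs z y} →
              Eval A (prec g h) (n ∷ xs) z → Eval A h (n ∷ z ∷ xs) y →
              Eval A (prec g h) (suc n ∷ xs) y
    ev-mu   : ∀ {k} {f : PR (suc k)} {xs y} →
              Eval A f (y ∷ xs) 0 →
              (∀ z → z < y → Σ ℕ λ w → Eval A f (z ∷ xs) (suc w)) →
              Eval A (mu f) xs y

  data EvalAll (A : ℕ → Bool) {k : ℕ} : ∀ {m} → Vec (PR k) m → Vec ℕ k → Vec ℕ m → Set where
    []  : ∀ {xs} → EvalAll A [] xs []
    _∷_ : ∀ {m} {h : PR k} {hs : Vec (PR k) m} {xs y ys} →
          Eval A h xs y → EvalAll A hs xs ys → EvalAll A (h ∷ hs) xs (y ∷ ys)

Computable : (ℕ → Bool) → (ℕ → Bool) → Set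
Computable A X = Σ (PR 1) λ c → ∀ n → Eval A c (n ∷ []) (b2n (X n))

_≤T_ : (ℕ → Bool) → (ℕ → Bool) → Set
X ≤T B = Computable B X

data Term (k : ℕ) : Set where
  var  : Fin k → Term k
  tzero : Term k
  tsuc : Term k → Term k
  _⊹_  : Term k → Term k → Term k
  _⊛_  : Term k → Term k → Term k

data Formula (k : ℕ) : Set where
  _≐_    : Term k → Term k → Formula k
  _≺_    : Term k → Term k → Formula k
  _∈G    : Term k → Formula k
  _∉G    : Term k → Formula k
  _∧̇_    : Formula k → Formula k → Formula k
  ¬̇_     : Formula k → Formula k
  ∃̇_     : Formula (suc k) → Formula k

⟦_⟧ : ∀ {k} → Term k → Vec ℕ k → ℕ
⟦ var i ⟧ ρ = lookup ρ i
⟦ tzero ⟧ ρ = 0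
⟦ tsuc t ⟧ ρ = suc (⟦ t ⟧ ρ)
⟦ t ⊹ s ⟧ ρ = ⟦ t ⟧ ρ + ⟦ s ⟧ ρ
⟦ t ⊛ s ⟧ ρ = ⟦ t ⟧ ρ * ⟦ s ⟧ ρ

wkT : ∀ {k} → Term k → Term (suc k)
wkT (var i) = var (Fin.suc i)
wkT tzero = tzero
wkT (tsuc t) = tsuc (wkT t)
wkT (t ⊹ s) = wkT t ⊹ wkT s
wkT (t ⊛ s) = wkT t ⊛ wkT s

data Δ₀ {k : ℕ} : Formula k → Set where
  d-eq  : ∀ {t s} → Δ₀ (t ≐ s)
  d-lt  : ∀ {t s} → Δ₀ (t ≺ s)
  d-in  : ∀ {t} → Δ₀ (t ∈G)
  d-nin : ∀ {t} → Δ₀ (t ∉G)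
  d-and : ∀ {φ ψ} → Δ₀ φ → Δ₀ ψ → Δ₀ (φ ∧̇ ψ)
  d-neg : ∀ {φ} → Δ₀ φ → Δ₀ (¬̇ φ)
  d-bex : ∀ {t : Term k} {φ} → Δ₀ φ → Δ₀ (∃̇ ((var Fin.zero ≺ wkT t) ∧̇ φ))

data Σ₁ {k : ℕ} : Formula k → Set where
  s-base : ∀ {φ} → Δ₀ φ → Σ₁ φ
  s-ex   : ∀ {φ} → Σ₁ {suc k} φ → Σ₁ (∃̇ φ)

-- Effective Gödel decoding ℕ → formulas (surjective)
toFin : (k r : ℕ) → Maybe (Fin k)
toFin zero _ = nothing
toFin (suc k) zero = just Fin.zero
toFin (suc k) (suc r) = Maybe.map Fin.suc (toFin k r)

decTermF : ∀ {k} → ℕ → ℕ → Term k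
decTermF zero _ = tzero
decTermF (suc f) zero = tzero
decTermF {k} (suc f) (suc m) with unpair m
... | (0 , r) = Maybe.maybe var tzero (toFin k r)
... | (1 , r) = tzero
... | (2 , r) = tsuc (decTermF f r)
... | (3 , r) = decTermF f (Data.Product.proj₁ (unpair r)) ⊹ decTermF f (Data.Product.proj₂ (unpair r))
... | (4 , r) = decTermF f (Data.Product.proj₁ (unpair r)) ⊛ decTermF f (Data.Product.proj₂ (unpair r))
... | _ = tzero

decTerm : ∀ {k} → ℕ → Term k
decTerm n = decTermF n n

decFormF : ∀ {k} → ℕ → ℕ → Formula k
decFormF zero _ = tzero ≐ tzero
decFormF (suc f) zero = tzero ≐ tzero
decFormF (suc f) (suc m) with unpair m
... | (0 , r) = decTerm (Data.Product.proj₁ (unpair r)) ≐ decTerm (Data.Product.proj₂ (unpair r))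
... | (1 , r) = decTerm (Data.Product.proj₁ (unpair r)) ≺ decTerm (Data.Product.proj₂ (unpair r))
... | (2 , r) = decTerm r ∈G
... | (3 , r) = decTerm r ∉G
... | (4 , r) = decFormF f (Data.Product.proj₁ (unpair r)) ∧̇ decFormF f (Data.Product.proj₂ (unpair r))
... | (5 , r) = ¬̇ decFormF f r
... | (6 , r) = ∃̇ decFormF f r
... | _ = tzero ≐ tzero

sentence : ℕ → Formula 0
sentence i = decFormF i i

-- the raw data (P, ≤, V) on ω;  le q p ≡ true  means  q ≤ p
record ForcingData : Set where
  field
    P  : ℕ → Bool
    le : ℕ → ℕ → Bool
    V  : ℕ → Str

record Forcing : Set where
  field
    dat : ForcingData
  open ForcingData dat public
  field
    P-infinite : ∀ n → Σ ℕ λ m → n ≤ m × P m ≡ true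
    le-refl    : ∀ p → P p ≡ true → le p p ≡ true
    le-trans   : ∀ p q r → P p ≡ true → P q ≡ true → P r ≡ true →
                 le p q ≡ true → le q r ≡ true → le p r ≡ true
    le-antisym : ∀ p q → P p ≡ true → P q ≡ true →
                 le p q ≡ true → le q p ≡ true → p ≡ q
    V-mono     : ∀ p q → P p ≡ true → P q ≡ true → le q p ≡ true → V p ≼ V q
    V-dense    : ∀ n p → P p ≡ true →
                 Σ ℕ λ q → P q ≡ true × le q p ≡ true × n ≤ length (V q)

module _ (D : ForcingData) where
  open ForcingData D

  Forces : ℕ → ∀ {k} → Formula k → Vec ℕ k → Set
  Forces p (t ≐ s) ρ = ⟦ t ⟧ ρ ≡ ⟦ s ⟧ ρ
  Forces p (t ≺ s) ρ = ⟦ t ⟧ ρ < ⟦ s ⟧ ρ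
  Forces p (t ∈G) ρ = bitAt (V p) (⟦ t ⟧ ρ) ≡ just true
  Forces p (t ∉G) ρ = bitAt (V p) (⟦ t ⟧ ρ) ≡ just false
  Forces p (φ ∧̇ ψ) ρ = Forces p φ ρ × Forces p ψ ρ
  Forces p (¬̇ φ) ρ = ∀ q → P q ≡ true → le q p ≡ true → ¬ Forces q φ ρ
  Forces p (∃̇ φ) ρ = Σ ℕ λ n → Forces p φ (n ∷ ρ)

  ComputableForcing : (ℕ → Bool) → Set
  ComputableForcing A =
    Computable A P ×
    (Σ (PR 2) λ c → ∀ p q → P p ≡ true → P q ≡ true →
        Eval A c (p ∷ q ∷ []) (b2n (le p q))) ×
    (Σ (PR 1) λ c → ∀ p → P p ≡ true → Eval A c (p ∷ []) (encStr (V p)))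

  OneDecidable : (ℕ → Bool) → Set
  OneDecidable A =
    ComputableForcing A ×
    Σ (PR 2) λ f₁ → Σ (PR 2) λ f₂ →
      ∀ p i → P p ≡ true → Σ ℕ λ q → Σ ℕ λ t →
        Eval A f₁ (p ∷ i ∷ []) q × Eval A f₂ (p ∷ i ∷ []) t ×
        P q ≡ true × le q p ≡ true × (t ≡ 1 ⊎ t ≡ 0) ×
        (Σ₁ (sentence i) →
          (t ≡ 1 → Forces q (sentence i) []) ×
          (t ≡ 0 → Forces q (¬̇ sentence i) []))

-- the product ℂ × ℙ; a condition (σ , p) is coded by n with unpair n = (code σ , p)
product : Forcing → ForcingData
product ℙ = record { P = P× ; le = le× ; V = V× }
  where
  open Forcing ℙ
  P× : ℕ → Bool
  P× n with unpair n
  ... | (a , b) = P b ∧ (length (decStr a) ==ᵇ length (V b))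
  le× : ℕ → ℕ → Bool
  le× n m with unpair n | unpair m
  ... | (a , b) | (c , d) = isPrefixᵇ (decStr c) (decStr a) ∧ le b d
  V× : ℕ → Str
  V× n with unpair n
  ... | (a , b) = interleave (decStr a) (V b)

module _ (ℙ : Forcing) where
  open Forcing ℙ

  IsFilter : (ℕ → Set) → Set
  IsFilter F =
    (∀ p → F p → P p ≡ true) ×
    (Σ ℕ F) ×
    (∀ p q → F p → P q ≡ true → le p q ≡ true → F q) ×
    (∀ p q → F p → F q → Σ ℕ λ r → F r × le r p ≡ true × le r q ≡ true)

  -- 𝒞 = {D e : e ∈ ω}
  IsGenericFilter : (ℕ → ℕ → Bool) → (ℕ → Set) → Set
  IsGenericFilter 𝒞 F =
    IsFilter F ×
    (∀ n → Σ ℕ λ p → F p × n ≤ length (V p)) ×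
    (∀ e → (Σ ℕ λ p → F p × 𝒞 e p ≡ true) ⊎
           (Σ ℕ λ p → F p × (∀ q → P q ≡ true → le q p ≡ true → 𝒞 e q ≡ false)))

  ValuationOf : (ℕ → Set) → (ℕ → Bool) → Set
  ValuationOf F G = ∀ n → Σ ℕ λ p → F p × bitAt (V p) n ≡ just (G n)

  IsGeneric : (ℕ → ℕ → Bool) → (ℕ → Bool) → Set₁
  IsGeneric 𝒞 G = Σ (ℕ → Set) λ F → IsGenericFilter 𝒞 F × ValuationOf F G

  ComputableDenseClass : (ℕ → Bool) → (ℕ → ℕ → Bool) → Set
  ComputableDenseClass A 𝒞 =
    (Σ (PR 2) λ c → ∀ e p → Eval A c (e ∷ p ∷ []) (b2n (𝒞 e p))) ×
    (∀ e p → 𝒞 e p ≡ true → P p ≡ true) ×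
    (∀ e p → P p ≡ true → Σ ℕ λ q → P q ≡ true × le q p ≡ true × 𝒞 e q ≡ true)

ComputableTree : (ℕ → Bool) → (Str → Bool) → Set
ComputableTree A T = Σ (PR 1) λ c → ∀ σ → Eval A c (encStr σ ∷ []) (b2n (T σ))

IsPerfectTree : (Str → Bool) → Set
IsPerfectTree T =
  T [] ≡ true ×
  (∀ σ τ → T (σ ++ τ) ≡ true → T σ ≡ true) ×
  (∀ σ → T σ ≡ true → Σ Str λ τ₁ → Σ Str λ τ₂ →
      T τ₁ ≡ true × T τ₂ ≡ true × σ ≼ τ₁ × σ ≼ τ₂ × ¬ (τ₁ ≼ τ₂) × ¬ (τ₂ ≼ τ₁))

IsPath : (Str → Bool) → (ℕ → Bool) → Set
IsPath T S = ∀ n → T (initSeg S n) ≡ true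

{-# OPTIONS --safe #-}
module Submission where

-- For a program c consider the Σ₁ sentence φ saying "with c, run on Ġ, in place of the oracle A, the program f₂
-- deciding ℂ × ℙ answers 0 at the condition m on the sentence φ itself". Let (q , t) be the true answer at m, and
-- let X be generic through q. If t = 1, then φ holds of X, and if t = 0, then φ fails of X; if c computed A from
-- X, then φ would hold of X exactly when t = 0. So c does not compute A from X.
--
-- It remains to arrange that q is met. At stage (d , n), all strings ρ on the positions decided so far are treated
-- in turn: the Cohen part of the current condition below n is overwritten by ρ on these positions, and the
-- diagonal sentence of d is decided there. The values that are added to the Cohen part do not depend on ρ, and
-- they fix the tree T except at one branching position per stage; the ℙ-part of the last condition is put into
-- 𝒞 d. That part is chosen at least as large as the number of the stage, which makes 𝒞 d decidable even though
-- P itself is only enumerable in A.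
open import Defs
open import Data.Bool using (Bool; true; false; _∧_; if_then_else_)
import Data.Bool.Properties as Bool
open import Data.Empty using (⊥)
open import Data.Fin using (Fin; zero; suc; toℕ)
open import Data.List using (List; []; _∷_; _++_; length; drop; replicate)
open import Data.List.Properties using (++-assoc; ++-identityʳ; length-++; length-replicate; length-drop; drop-[])
open import Data.Maybe using (Maybe; just; nothing; fromMaybe)
import Data.Maybe as Maybe
open import Data.Maybe.Properties using (just-injective)
open import Data.Nat using (ℕ; zero; suc; pred; _≤_; _<_; _+_; _*_; _∸_; _^_; _!; z≤n; s≤s; >-nonZero; _≟_; _≤?_; _<?_)
open import Data.Nat.Coprimality using (Coprime; coprime-Bézout; coprime-divisor; 1-coprimeTo)
open import Data.Nat.DivMod using (_%_; _/_; m≡m%n+[m/n]*n; [m+kn]%n≡m%n; m<n⇒m%n≡m; m/n≤m)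
open import Data.Nat.Divisibility using (_∣_; divides; ∣-refl; ∣-trans; m∣m*n; ∣n⇒∣m*n; ∣m⇒∣m*n; ∣m+n∣m⇒∣n; ∣1⇒≡1; m≤n⇒m!∣n!)
open import Data.Nat.GCD using (module Bézout)
open import Data.Nat.Properties
open import Data.Nat.Solver using (module +-*-Solver)
open import Data.Product using (Σ; _×_; _,_; proj₁; proj₂)
open import Data.Sum using (_⊎_; inj₁; inj₂)
open import Data.Unit using (⊤; tt)
open import Data.Vec using (Vec; []; _∷_; lookup; map; tabulate) renaming (_++_ to _++ᵛ_)
open import Data.Vec.Properties using (tabulate∘lookup)
open import Relation.Binary.Definitions using (tri<; tri≈; tri>)
open import Relation.Binary.PropositionalEquality
open import Relation.Nullary using (¬_; Dec; yes; no; contradiction; ¬?; _×-dec_; decidable-stable)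

-- All strings ρ are treated because a path S may take any values at the branching positions, while
-- genericity for ℙ controls only the ℙ-part. Once the ℙ-part of the last condition of a stage lies
-- in the filter, upward closure puts the ℙ-parts of all answers of that stage there; among these
-- answers, the one for the string ρ that begins S also has its Cohen part along S. The sentence
-- names the condition m at which it is asked, since the contradiction concerns the answer of `f₂`
-- at exactly m; so each overwriting asks a sentence of its own. Stages do not extend one another.
-- Stage (d , n) starts from n, whence the density of 𝒞 d, and hands on only the length of its Cohen
-- part. S itself is not generic. To pass from forcing to truth, for a Σ₁ sentence or its negation,
-- it is enough that the conditions made from S and the filter have arbitrarily long valuations. P
-- is enumerable in A because p belongs to P if some string σ gives a condition (σ , p); the length
-- that σ must have is not known in advance.

-- Determinism and relativization of oracle computations

mutual
  Eval-det : ∀ {A k} {f : PR k} {xs y z} → Eval A f xs y → Eval A f xs z → y ≡ z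
  Eval-det ev-zer ev-zer = refl
  Eval-det ev-succ ev-succ = refl
  Eval-det ev-proj ev-proj = refl
  Eval-det ev-orc ev-orc = refl
  Eval-det (ev-comp ds d) (ev-comp es e) with EvalAll-det ds es
  ... | refl = Eval-det d e
  Eval-det (ev-prec0 d) (ev-prec0 e) = Eval-det d e
  Eval-det (ev-precS d d′) (ev-precS e e′) with Eval-det d e
  ... | refl = Eval-det d′ e′
  Eval-det {y = y} {z} (ev-mu d ds) (ev-mu e es) with <-cmp y z
  ... | tri≈ _ y≡z _ = y≡z
  -- Of two distinct least zeros, the smaller would carry both the value 0 and a positive value.
  ... | tri< y<z _ _ with () ← Eval-det d (proj₂ (es y y<z))
  ... | tri> _ _ z<y with () ← Eval-det (proj₂ (ds z z<y)) e

  EvalAll-det : ∀ {A k m} {fs : Vec (PR k) m} {xs ys zs} →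
                EvalAll A fs xs ys → EvalAll A fs xs zs → ys ≡ zs
  EvalAll-det [] [] = refl
  EvalAll-det (d ∷ ds) (e ∷ es) with Eval-det d e | EvalAll-det ds es
  ... | refl | refl = refl

mutual
  _[orc≔_] : ∀ {k} → PR k → PR 1 → PR k
  zer [orc≔ c ] = zer
  succ [orc≔ c ] = succ
  proj i [orc≔ c ] = proj i
  orc [orc≔ c ] = c
  comp g hs [orc≔ c ] = comp (g [orc≔ c ]) (hs [all-orc≔ c ])
  prec g h [orc≔ c ] = prec (g [orc≔ c ]) (h [orc≔ c ])
  mu f [orc≔ c ] = mu (f [orc≔ c ])

  _[all-orc≔_] : ∀ {k m} → Vec (PR k) m → PR 1 → Vec (PR k) m
  [] [all-orc≔ c ] = []
  (h ∷ hs) [all-orc≔ c ] = h [orc≔ c ] ∷ hs [all-orc≔ c ]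

module _ {A B : ℕ → Bool} {c : PR 1} (c-computes : ∀ n → Eval B c (n ∷ []) (b2n (A n))) where
  mutual
    -- Each oracle query is answered by running `c`. This direction suffices: `f₂` is known to halt
    -- with oracle A, and `Eval-det` makes the transferred value the only one.
    Eval-relativize : ∀ {k} {f : PR k} {xs y} → Eval A f xs y → Eval B (f [orc≔ c ]) xs y
    Eval-relativize ev-zer = ev-zer
    Eval-relativize ev-succ = ev-succ
    Eval-relativize ev-proj = ev-proj
    Eval-relativize ev-orc = c-computes _
    Eval-relativize (ev-comp ds d) = ev-comp (EvalAll-relativize ds) (Eval-relativize d)
    Eval-relativize (ev-prec0 d) = ev-prec0 (Eval-relativize d)
    Eval-relativize (ev-precS d e) = ev-precS (Eval-relativize d) (Eval-relativize e)
    Eval-relativize (ev-mu d ds) =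
      ev-mu (Eval-relativize d) (λ z z<y → proj₁ (ds z z<y) , Eval-relativize (proj₂ (ds z z<y)))

    EvalAll-relativize : ∀ {k m} {fs : Vec (PR k) m} {xs ys} →
                         EvalAll A fs xs ys → EvalAll B (fs [all-orc≔ c ]) xs ys
    EvalAll-relativize [] = []
    EvalAll-relativize (d ∷ ds) = Eval-relativize d ∷ EvalAll-relativize ds

-- Gödel's β-function

coprime-* : ∀ {m n k} → Coprime m k → Coprime n k → Coprime (m * n) k
coprime-* {m} {n} m⊥k n⊥k {d} (d∣mn , d∣k) = n⊥k (coprime-divisor d⊥m d∣mn , d∣k)
  where
  d⊥m : Coprime d m
  d⊥m (e∣d , e∣m) = m⊥k (e∣m , ∣-trans e∣d d∣k)

-- The multiplier solving a + k M ≡ v is M⁻¹ (v - a), written with the representative m of -1 modulo suc m.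
linear-congruence : ∀ {M m} → Coprime M (suc m) → ∀ a v → Σ ℕ λ k → (a + k * M) % suc m ≡ v % suc m
linear-congruence {M} {m} M⊥m a v with coprime-Bézout M⊥m
... | Bézout.+- x y eq = x * (v + a * m) , (begin
  (a + x * (v + a * m) * M) % suc m                          ≡⟨ cong (_% suc m) expand ⟩
  (v + (a + y * (v + a * m)) * suc m) % suc m                ≡⟨ [m+kn]%n≡m%n v (a + y * (v + a * m)) (suc m) ⟩
  v % suc m ∎)
  where
  open ≡-Reasoning
  open +-*-Solver using (solve; _:+_; _:*_; _:=_; con)
  expand : a + x * (v + a * m) * M ≡ v + (a + y * (v + a * m)) * suc m
  expand = begin
    a + x * (v + a * m) * M
      ≡⟨ solve 5 (λ a x v m M → a :+ x :* (v :+ a :* m) :* M := a :+ (v :+ a :* m) :* (x :* M)) refl a x v m M ⟩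
    a + (v + a * m) * (x * M)
      ≡⟨ cong (λ z → a + (v + a * m) * z) (sym eq) ⟩
    a + (v + a * m) * (1 + y * suc m)
      ≡⟨ solve 4 (λ a v m y → a :+ (v :+ a :* m) :* (con 1 :+ y :* (con 1 :+ m))
                           := v :+ (a :+ y :* (v :+ a :* m)) :* (con 1 :+ m)) refl a v m y ⟩
    v + (a + y * (v + a * m)) * suc m ∎
... | Bézout.-+ x y eq = x * (a + v * m) , (begin
  (a + x * (a + v * m) * M) % suc m                          ≡⟨ [m+kn]%n≡m%n (a + x * (a + v * m) * M) v (suc m) ⟨
  (a + x * (a + v * m) * M + v * suc m) % suc m              ≡⟨ cong (_% suc m) expand ⟩
  (v + y * (a + v * m) * suc m) % suc m                      ≡⟨ [m+kn]%n≡m%n v (y * (a + v * m)) (suc m) ⟩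
  v % suc m ∎)
  where
  open ≡-Reasoning
  open +-*-Solver using (solve; _:+_; _:*_; _:=_; con)
  expand : a + x * (a + v * m) * M + v * suc m ≡ v + y * (a + v * m) * suc m
  expand = begin
    a + x * (a + v * m) * M + v * suc m
      ≡⟨ solve 5 (λ a x v m M → a :+ x :* (a :+ v :* m) :* M :+ v :* (con 1 :+ m)
                             := v :+ (a :+ v :* m) :* (con 1 :+ x :* M)) refl a x v m M ⟩
    v + (a + v * m) * (1 + x * M)
      ≡⟨ cong (λ z → v + (a + v * m) * z) eq ⟩
    v + (a + v * m) * (y * suc m)
      ≡⟨ solve 4 (λ a v m y → v :+ (a :+ v :* m) :* (y :* (con 1 :+ m))
                           := v :+ y :* (a :+ v :* m) :* (con 1 :+ m)) refl a v m y ⟩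
    v + y * (a + v * m) * suc m ∎

-- The induction carries a common multiple `M` of the moduli treated so far. Adding multiples of `M`
-- keeps the old congruences, and by the last conjunct `M` is coprime to the next modulus, so that
-- `linear-congruence` can meet the new one.
chinese-remainder : (m v : ℕ → ℕ) (n : ℕ) →
  (∀ i j → i < j → j < n → Coprime (suc (m i)) (suc (m j))) →
  Σ ℕ λ a → Σ ℕ λ M →
    (∀ i → i < n → a % suc (m i) ≡ v i % suc (m i)) ×
    (∀ i → i < n → suc (m i) ∣ M) ×
    (∀ k → (∀ i → i < n → Coprime (suc (m i)) k) → Coprime M k)
chinese-remainder m v zero _ = 0 , 1 , (λ _ ()) , (λ _ ()) , λ k _ → 1-coprimeTo k
chinese-remainder m v (suc n) m⊥m
  with chinese-remainder m v n (λ i j i<j j<n → m⊥m i j i<j (m<n⇒m<1+n j<n))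
... | a , M , a≡v , m∣M , M⊥
  with linear-congruence (M⊥ (suc (m n)) (λ i i<n → m⊥m i n i<n ≤-refl)) a (v n)
... | k , a+kM≡v = a + k * M , suc (m n) * M , a′≡v , m∣M′ , M′⊥
  where
  a′≡v : ∀ i → i < suc n → (a + k * M) % suc (m i) ≡ v i % suc (m i)
  a′≡v i i<1+n with m<1+n⇒m<n∨m≡n i<1+n
  ... | inj₂ refl = a+kM≡v
  ... | inj₁ i<n with m∣M i i<n
  ...   | divides q refl = begin
    (a + k * (q * suc (m i))) % suc (m i) ≡⟨ cong (λ z → (a + z) % suc (m i)) (*-assoc k q (suc (m i))) ⟨
    (a + k * q * suc (m i)) % suc (m i)   ≡⟨ [m+kn]%n≡m%n a (k * q) (suc (m i)) ⟩
    a % suc (m i)                         ≡⟨ a≡v i i<n ⟩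
    v i % suc (m i) ∎
    where open ≡-Reasoning
  m∣M′ : ∀ i → i < suc n → suc (m i) ∣ suc (m n) * M
  m∣M′ i i<1+n with m<1+n⇒m<n∨m≡n i<1+n
  ... | inj₁ i<n = ∣n⇒∣m*n (suc (m n)) (m∣M i i<n)
  ... | inj₂ refl = m∣m*n M
  M′⊥ : ∀ k → (∀ i → i < suc n → Coprime (suc (m i)) k) → Coprime (suc (m n) * M) k
  M′⊥ k m⊥k = coprime-* (m⊥k n ≤-refl) (M⊥ k (λ i i<n → m⊥k i (m<n⇒m<1+n i<n)))

-- a and b code the sequence i ↦ a mod (1 + (i + 1) b).
β : ℕ → ℕ → ℕ → ℕ → Set
β a b i v = v < suc (suc i * b) × Σ ℕ λ q → q < suc a × a ≡ q * suc (suc i * b) + v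

β-% : ∀ a b i {v} → β a b i v → a % suc (suc i * b) ≡ v
β-% a b i {v} (v<m , q , _ , refl) = begin
  (q * suc (suc i * b) + v) % suc (suc i * b) ≡⟨ cong (_% suc (suc i * b)) (+-comm (q * suc (suc i * b)) v) ⟩
  (v + q * suc (suc i * b)) % suc (suc i * b) ≡⟨ [m+kn]%n≡m%n v q (suc (suc i * b)) ⟩
  v % suc (suc i * b)                         ≡⟨ m<n⇒m%n≡m v<m ⟩
  v ∎
  where open ≡-Reasoning

β-functional : ∀ a b i {v v′} → β a b i v → β a b i v′ → v ≡ v′
β-functional a b i βv βv′ = trans (sym (β-% a b i βv)) (β-% a b i βv′)

-- A common divisor `e` is coprime to `b`, because it divides a number of the form 1 + (i + 1) b. It
-- divides the difference (d + 1) b of the moduli, hence d + 1, hence `b`, and so it is 1.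
β-moduli-coprime : ∀ {b} i d → suc d ∣ b → Coprime (suc (suc i * b)) (suc (suc (i + suc d) * b))
β-moduli-coprime {b} i d d∣b {e} (e∣mᵢ , e∣mⱼ) = e⊥b (∣-refl , e∣b)
  where
  open +-*-Solver using (solve; _:+_; _:*_; _:=_; con)
  mⱼ≡ : suc (suc (i + suc d) * b) ≡ suc (suc i * b) + suc d * b
  mⱼ≡ = solve 3 (λ i d b → con 1 :+ (con 1 :+ (i :+ (con 1 :+ d))) :* b
                        := con 1 :+ (con 1 :+ i) :* b :+ (con 1 :+ d) :* b) refl i d b
  e⊥b : Coprime e b
  e⊥b {f} (f∣e , f∣b) = ∣1⇒≡1 (∣m+n∣m⇒∣n {m = suc i * b}
    (subst (f ∣_) (+-comm 1 (suc i * b)) (∣-trans f∣e e∣mᵢ)) (∣n⇒∣m*n (suc i) f∣b))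
  e∣b : e ∣ b
  e∣b = ∣-trans (coprime-divisor e⊥b (subst (e ∣_) (*-comm (suc d) b)
          (∣m+n∣m⇒∣n (subst (e ∣_) mⱼ≡ e∣mⱼ) e∣mᵢ))) d∣b

bounded-values : (v : ℕ → ℕ) (n : ℕ) → Σ ℕ λ M → ∀ i → i < n → v i ≤ M
bounded-values v zero = 0 , λ _ ()
bounded-values v (suc n) with bounded-values v n
... | M , v≤M = v n + M , v≤
  where
  v≤ : ∀ i → i < suc n → v i ≤ v n + M
  v≤ i i<1+n with m<1+n⇒m<n∨m≡n i<1+n
  ... | inj₁ i<n = m≤n⇒m≤o+n (v n) (v≤M i i<n)
  ... | inj₂ refl = m≤m+n (v n) M

β-exists : (v : ℕ → ℕ) (n : ℕ) → Σ ℕ λ a → Σ ℕ λ b → ∀ i → i < n → β a b i (v i)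
β-exists v n with bounded-values v n
-- In the choice of b as n! M, the factor n! is divisible by all differences of indices, which makes
-- the moduli coprime, and `M` makes each modulus exceed the value to be coded.
... | M , v≤M with chinese-remainder (λ i → suc i * (n ! * M)) v n m⊥m
  where
  m⊥m : ∀ i j → i < j → j < n → Coprime (suc (suc i * (n ! * M))) (suc (suc j * (n ! * M)))
  m⊥m i j i<j j<n with m≤n⇒∃[o]m+o≡n i<j
  ... | d , refl = subst (λ j → Coprime (suc (suc i * (n ! * M))) (suc (suc j * (n ! * M)))) (+-suc i d)
    (β-moduli-coprime i d (∣m⇒∣m*n M (∣-trans (m∣m*n (d !)) (m≤n⇒m!∣n! (≤-trans (s≤s (m≤n+m d i)) (<⇒≤ j<n))))))
... | a , _ , a≡v , _ = a , n ! * M , λ i i<n →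
  let m = suc (suc i * (n ! * M))
      vi<m = s≤s (≤-trans (v≤M i i<n) (≤-trans (m≤n*m M (n !) {{n !≢0}}) (m≤m+n _ _)))
  in vi<m , a / m , s≤s (m/n≤m a m) ,
     trans (m≡m%n+[m/n]*n a m) (trans (+-comm _ (a / m * m))
       (cong (a / m * m +_) (trans (a≡v i i<n) (m<n⇒m%n≡m vi<m))))

-- Arithmetization of computations with an oracle

-- The bounded formulas as a datatype of their own, so that satisfaction, use and the comparison
-- with forcing are structural recursions. Non-membership is expressed by `negᶠ` of `memᶠ`.
data BFormula (k : ℕ) : Set where
  eqᶠ ltᶠ : Term k → Term k → BFormula k
  memᶠ   : Term k → BFormula k
  andᶠ   : BFormula k → BFormula k → BFormula k
  negᶠ   : BFormula k → BFormula k
  exᶠ    : Term k → BFormula (suc k) → BFormula k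

⌊_⌋ : ∀ {k} → BFormula k → Formula k
⌊ eqᶠ t s ⌋  = t ≐ s
⌊ ltᶠ t s ⌋  = t ≺ s
⌊ memᶠ t ⌋   = t ∈G
⌊ andᶠ φ ψ ⌋ = ⌊ φ ⌋ ∧̇ ⌊ ψ ⌋
⌊ negᶠ φ ⌋   = ¬̇ ⌊ φ ⌋
⌊ exᶠ t φ ⌋  = ∃̇ ((var zero ≺ wkT t) ∧̇ ⌊ φ ⌋)

⌊⌋-Δ₀ : ∀ {k} (φ : BFormula k) → Δ₀ ⌊ φ ⌋
⌊⌋-Δ₀ (eqᶠ t s)  = d-eq
⌊⌋-Δ₀ (ltᶠ t s)  = d-lt
⌊⌋-Δ₀ (memᶠ t)   = d-in
⌊⌋-Δ₀ (andᶠ φ ψ) = d-and (⌊⌋-Δ₀ φ) (⌊⌋-Δ₀ ψ)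
⌊⌋-Δ₀ (negᶠ φ)   = d-neg (⌊⌋-Δ₀ φ)
⌊⌋-Δ₀ (exᶠ t φ)  = d-bex (⌊⌋-Δ₀ φ)

Sat : ∀ {k} → (ℕ → Bool) → BFormula k → Vec ℕ k → Set
Sat X (eqᶠ t s) ρ  = ⟦ t ⟧ ρ ≡ ⟦ s ⟧ ρ
Sat X (ltᶠ t s) ρ  = ⟦ t ⟧ ρ < ⟦ s ⟧ ρ
Sat X (memᶠ t) ρ   = X (⟦ t ⟧ ρ) ≡ true
Sat X (andᶠ φ ψ) ρ = Sat X φ ρ × Sat X ψ ρ
Sat X (negᶠ φ) ρ   = ¬ Sat X φ ρ
Sat X (exᶠ t φ) ρ  = Σ ℕ λ v → v < ⟦ t ⟧ ρ × Sat X φ (v ∷ ρ)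

-- Decidability is what allows `or` and `all`, which are defined through negation, to be eliminated
-- constructively.
sat? : ∀ {k} X (φ : BFormula k) ρ → Dec (Sat X φ ρ)
sat? X (eqᶠ t s) ρ  = ⟦ t ⟧ ρ ≟ ⟦ s ⟧ ρ
sat? X (ltᶠ t s) ρ  = ⟦ t ⟧ ρ <? ⟦ s ⟧ ρ
sat? X (memᶠ t) ρ   = X (⟦ t ⟧ ρ) Bool.≟ true
sat? X (andᶠ φ ψ) ρ = sat? X φ ρ ×-dec sat? X ψ ρ
sat? X (negᶠ φ) ρ   = ¬? (sat? X φ ρ)
sat? X (exᶠ t φ) ρ  = anyUpTo? (λ v → sat? X φ (v ∷ ρ)) (⟦ t ⟧ ρ)

or : ∀ {k} → BFormula k → BFormula k → BFormula k
or φ ψ = negᶠ (andᶠ (negᶠ φ) (negᶠ ψ))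

all : ∀ {k} → Term k → BFormula (suc k) → BFormula k
all t φ = negᶠ (exᶠ t (negᶠ φ))

⟦_⟧* : ∀ {n k} → Vec (Term n) k → Vec ℕ n → Vec ℕ k
⟦ [] ⟧* ρ = []
⟦ t ∷ ts ⟧* ρ = ⟦ t ⟧ ρ ∷ ⟦ ts ⟧* ρ

⟦wkT⟧ : ∀ {n} (t : Term n) {ρ v} → ⟦ wkT t ⟧ (v ∷ ρ) ≡ ⟦ t ⟧ ρ
⟦wkT⟧ (var i)  = refl
⟦wkT⟧ tzero    = refl
⟦wkT⟧ (tsuc t) = cong suc (⟦wkT⟧ t)
⟦wkT⟧ (t ⊹ s)  = cong₂ _+_ (⟦wkT⟧ t) (⟦wkT⟧ s)
⟦wkT⟧ (t ⊛ s)  = cong₂ _*_ (⟦wkT⟧ t) (⟦wkT⟧ s)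

⟦wkT⟧* : ∀ {n k} (ts : Vec (Term n) k) {ρ v} → ⟦ map wkT ts ⟧* (v ∷ ρ) ≡ ⟦ ts ⟧* ρ
⟦wkT⟧* []       = refl
⟦wkT⟧* (t ∷ ts) = cong₂ _∷_ (⟦wkT⟧ t) (⟦wkT⟧* ts)

⟦lookup⟧ : ∀ {n k} (ts : Vec (Term n) k) i {ρ} → ⟦ lookup ts i ⟧ ρ ≡ lookup (⟦ ts ⟧* ρ) i
⟦lookup⟧ (t ∷ ts) zero    = refl
⟦lookup⟧ (t ∷ ts) (suc i) = ⟦lookup⟧ ts i

wk : ∀ m {n} → Term n → Term (m + n)
wk zero    t = t
wk (suc m) t = wkT (wk m t)

wks : ∀ m {n k} → Vec (Term n) k → Vec (Term (m + n)) k
wks m = map (wk m)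

⟦wk⟧ : ∀ {m n} (vs : Vec ℕ m) (t : Term n) {ρ} → ⟦ wk m t ⟧ (vs ++ᵛ ρ) ≡ ⟦ t ⟧ ρ
⟦wk⟧ []               t = refl
⟦wk⟧ {suc m} (v ∷ vs) t = trans (⟦wkT⟧ (wk m t)) (⟦wk⟧ vs t)

⟦wks⟧ : ∀ {m n k} (vs : Vec ℕ m) (ts : Vec (Term n) k) {ρ} → ⟦ wks m ts ⟧* (vs ++ᵛ ρ) ≡ ⟦ ts ⟧* ρ
⟦wks⟧ vs []       = refl
⟦wks⟧ vs (t ∷ ts) = cong₂ _∷_ (⟦wk⟧ vs t) (⟦wks⟧ vs ts)

vars : ∀ m {n} → Vec (Term (m + n)) m
vars zero    = []
vars (suc m) = var zero ∷ map wkT (vars m)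

⟦vars⟧ : ∀ {m n} (vs : Vec ℕ m) {ρ : Vec ℕ n} → ⟦ vars m ⟧* (vs ++ᵛ ρ) ≡ vs
⟦vars⟧ []       = refl
⟦vars⟧ {suc m} (v ∷ vs) = cong (v ∷_) (trans (⟦wkT⟧* (vars m)) (⟦vars⟧ vs))

Bounded : ∀ {m} → ℕ → Vec ℕ m → Set
Bounded b []       = ⊤
Bounded b (v ∷ vs) = v < b × Bounded b vs

Bounded-mono : ∀ {m b c} → b ≤ c → (vs : Vec ℕ m) → Bounded b vs → Bounded c vs
Bounded-mono b≤c []       _          = tt
Bounded-mono b≤c (v ∷ vs) (v<b , vs<b) = ≤-trans v<b b≤c , Bounded-mono b≤c vs vs<b

-- The last entry of the block is bound outermost, so that the matrix is read in the environment
-- `vs ++ᵛ ρ`; the bound is one term of the outer context.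
exs : ∀ m {n} → Term n → BFormula (m + n) → BFormula n
exs zero    t φ = φ
exs (suc m) t φ = exs m t (exᶠ (wk m t) φ)

βF : ∀ {n} → Term n → Term n → Term n → Term n → BFormula n
βF a b i v = andᶠ (ltᶠ v (tsuc (tsuc i ⊛ b)))
                 (exᶠ (tsuc a) (eqᶠ (wkT a) ((var zero ⊛ wkT (tsuc (tsuc i ⊛ b))) ⊹ wkT v)))

v₀ : ∀ {n} → Term (suc n)
v₀ = var zero
v₁ : ∀ {n} → Term (suc (suc n))
v₁ = var (suc zero)
v₂ : ∀ {n} → Term (suc (suc (suc n)))
v₂ = var (suc (suc zero))
v₃ : ∀ {n} → Term (suc (suc (suc (suc n))))
v₃ = var (suc (suc (suc zero)))
v₄ : ∀ {n} → Term (suc (suc (suc (suc (suc n)))))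
v₄ = var (suc (suc (suc (suc zero))))

-- graph f w xs y says that f, applied to xs, has value y, as witnessed by numbers below w.
mutual
  graph : ∀ {k} → PR k → ∀ {n} → Term n → Vec (Term n) k → Term n → BFormula n
  graph zer      w xs y = eqᶠ y tzero
  graph succ     w (x ∷ []) y = eqᶠ y (tsuc x)
  graph (proj i) w xs y = eqᶠ y (lookup xs i)
  graph orc      w (x ∷ []) y = or (andᶠ (memᶠ x) (eqᶠ y (tsuc tzero))) (andᶠ (negᶠ (memᶠ x)) (eqᶠ y tzero))
  graph (comp {m = m} g hs) w xs y =
    exs m w (compBody g hs w xs y)
  graph (prec g h) w (x ∷ xs) y =
    exs 2 w (precBody g h w x xs y)
  graph (mu f) w xs y =
    andᶠ (graph f w (y ∷ xs) tzero)
        (all y (muBody f w xs))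

  compBody : ∀ {k m} → PR m → Vec (PR k) m → ∀ {n} → Term n → Vec (Term n) k → Term n → BFormula (m + n)
  compBody {m = m} g hs w xs y =
    andᶠ (graphs hs (wk m w) (wks m xs) (vars m)) (graph g (wk m w) (vars m) (wk m y))

  muBody : ∀ {k} → PR (suc k) → ∀ {n} → Term n → Vec (Term n) k → BFormula (suc n)
  muBody f w xs = exᶠ (wk 1 w) (graph f (wk 2 w) (v₁ ∷ wks 2 xs) (tsuc v₀))

  -- The two outer witnesses `v₁` and `v₀` are the β-code a, b of the whole sequence of values of
  -- the recursion up to the argument `x`.
  precBody : ∀ {k} → PR k → PR (2 + k) → ∀ {n} → Term n → Term n → Vec (Term n) k → Term n → BFormula (2 + n)
  precBody g h w x xs y = andᶠ (andᶠ (precBase g w xs) (precStep h w x xs)) (βF v₁ v₀ (wk 2 x) (wk 2 y))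

  precBase : ∀ {k} → PR k → ∀ {n} → Term n → Vec (Term n) k → BFormula (2 + n)
  precBase g w xs = exᶠ (wk 2 w) (andᶠ (βF v₂ v₁ tzero v₀) (graph g (wk 3 w) (wks 3 xs) v₀))

  precStep : ∀ {k} → PR (2 + k) → ∀ {n} → Term n → Term n → Vec (Term n) k → BFormula (2 + n)
  precStep h w x xs = all (wk 2 x) (exs 2 (wk 3 w) (stepBody h w xs))

  -- Here `v₄` and `v₃` are the β-code, `v₂` is the index i, and `v₁` and `v₀` are the entries at i
  -- and i + 1.
  stepBody : ∀ {k} → PR (2 + k) → ∀ {n} → Term n → Vec (Term n) k → BFormula (5 + n)
  stepBody h w xs = andᶠ (andᶠ (βF v₄ v₃ v₂ v₁) (βF v₄ v₃ (tsuc v₂) v₀))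
                        (graph h (wk 5 w) (v₂ ∷ v₁ ∷ wks 5 xs) v₀)

  graphs : ∀ {k m} → Vec (PR k) m → ∀ {n} → Term n → Vec (Term n) k → Vec (Term n) m → BFormula n
  graphs []       w xs []       = eqᶠ tzero tzero
  graphs (h ∷ hs) w xs (y ∷ ys) = andᶠ (graph h w xs y) (graphs hs w xs ys)

-- Soundness and completeness of the arithmetization

uniform-bound : (P : ℕ → ℕ → Set) → (∀ {i b c} → b ≤ c → P i b → P i c) →
                ∀ n → (∀ i → i < n → Σ ℕ (P i)) → Σ ℕ λ b → ∀ i → i < n → P i b
uniform-bound P mono zero    p = 0 , λ _ ()
uniform-bound P mono (suc n) p
  with uniform-bound P mono n (λ i i<n → p i (m<n⇒m<1+n i<n)) | p n ≤-refl
... | b , q | c , r = b + c , λ i i<1+n → case i (m<1+n⇒m<n∨m≡n i<1+n)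
  where
  case : ∀ i → i < n ⊎ i ≡ n → P i (b + c)
  case i (inj₁ i<n)  = mono (m≤m+n b c) (q i i<n)
  case i (inj₂ refl) = mono (m≤n+m c b) r

extend : ℕ → (ℕ → ℕ) → ℕ → ℕ → ℕ
extend n z y i with i ≤? n
... | yes _ = z i
... | no _  = y

extend-≤ : ∀ n z y {i} → i ≤ n → extend n z y i ≡ z i
extend-≤ n z y {i} i≤n with i ≤? n
... | yes _  = refl
... | no i≰n = contradiction i≤n i≰n

extend-suc : ∀ n z y → extend n z y (suc n) ≡ y
extend-suc n z y with suc n ≤? n
... | yes n<n = contradiction n<n (<-irrefl refl)
... | no _    = refl

module _ (X : ℕ → Bool) where
  or-elim : ∀ {k} (φ ψ : BFormula k) {ρ} → Sat X (or φ ψ) ρ → Sat X φ ρ ⊎ Sat X ψ ρ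
  or-elim φ ψ {ρ} ¬¬ with sat? X φ ρ | sat? X ψ ρ
  ... | yes p | _     = inj₁ p
  ... | no _  | yes q = inj₂ q
  ... | no ¬p | no ¬q = contradiction (¬p , ¬q) ¬¬

  or-intro : ∀ {k} (φ ψ : BFormula k) {ρ} → Sat X φ ρ ⊎ Sat X ψ ρ → Sat X (or φ ψ) ρ
  or-intro φ ψ (inj₁ p) (¬p , _) = ¬p p
  or-intro φ ψ (inj₂ q) (_ , ¬q) = ¬q q

  all-elim : ∀ {k} (t : Term k) φ {ρ} → Sat X (all t φ) ρ → ∀ v → v < ⟦ t ⟧ ρ → Sat X φ (v ∷ ρ)
  all-elim t φ ∀φ v v<t = decidable-stable (sat? X φ _) (λ ¬φ → ∀φ (v , v<t , ¬φ))

  all-intro : ∀ {k} (t : Term k) φ {ρ} → (∀ v → v < ⟦ t ⟧ ρ → Sat X φ (v ∷ ρ)) → Sat X (all t φ) ρ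
  all-intro t φ ∀φ (v , v<t , ¬φ) = ¬φ (∀φ v v<t)

  exs-elim : ∀ m {n} (t : Term n) φ {ρ} → Sat X (exs m t φ) ρ → Σ (Vec ℕ m) λ vs → Sat X φ (vs ++ᵛ ρ)
  exs-elim zero    t φ s = [] , s
  exs-elim (suc m) t φ s with exs-elim m t _ s
  ... | vs , v , _ , s′ = v ∷ vs , s′

  exs-intro : ∀ {m} {n} (t : Term n) φ {ρ} (vs : Vec ℕ m) → Bounded (⟦ t ⟧ ρ) vs →
              Sat X φ (vs ++ᵛ ρ) → Sat X (exs m t φ) ρ
  exs-intro t φ []       _ s = s
  exs-intro t φ (v ∷ vs) (v<t , vs<t) s =
    exs-intro t _ vs vs<t (v , subst (v <_) (sym (⟦wk⟧ vs t)) v<t , s)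

  βF-elim : ∀ {n} {ρ : Vec ℕ n} a b i v → Sat X (βF a b i v) ρ → β (⟦ a ⟧ ρ) (⟦ b ⟧ ρ) (⟦ i ⟧ ρ) (⟦ v ⟧ ρ)
  βF-elim {ρ = ρ} a b i v (v<m , q , q≤a , a≡)
    rewrite ⟦wkT⟧ a {ρ} {q} | ⟦wkT⟧ b {ρ} {q} | ⟦wkT⟧ i {ρ} {q} | ⟦wkT⟧ v {ρ} {q} = v<m , q , q≤a , a≡

  βF-intro : ∀ {n} {ρ : Vec ℕ n} a b i v → β (⟦ a ⟧ ρ) (⟦ b ⟧ ρ) (⟦ i ⟧ ρ) (⟦ v ⟧ ρ) → Sat X (βF a b i v) ρ
  βF-intro {ρ = ρ} a b i v (v<m , q , q≤a , a≡) = v<m , q , q≤a , a≡′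
    where
    a≡′ : Sat X (eqᶠ (wkT a) ((var zero ⊛ wkT (tsuc (tsuc i ⊛ b))) ⊹ wkT v)) (q ∷ ρ)
    a≡′ rewrite ⟦wkT⟧ a {ρ} {q} | ⟦wkT⟧ b {ρ} {q} | ⟦wkT⟧ i {ρ} {q} | ⟦wkT⟧ v {ρ} {q} = a≡

  mutual
    -- The size of `w` does not enter: witnesses found below any bound are genuine, and `w` has to
    -- be large only for completeness.
    graph-sound : ∀ {k} (f : PR k) {n} (w : Term n) xs y {ρ us v} → ⟦ xs ⟧* ρ ≡ us → ⟦ y ⟧ ρ ≡ v →
                  Sat X (graph f w xs y) ρ → Eval X f us v
    graph-sound zer w xs y refl refl s rewrite s = ev-zer
    graph-sound succ w (x ∷ []) y refl refl s rewrite s = ev-succ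
    graph-sound (proj i) w xs y {ρ} refl refl s rewrite s | ⟦lookup⟧ xs i {ρ} = ev-proj
    graph-sound orc w (x ∷ []) y {ρ} refl refl s
      with or-elim (andᶠ (memᶠ x) (eqᶠ y (tsuc tzero))) (andᶠ (negᶠ (memᶠ x)) (eqᶠ y tzero)) s
    ... | inj₁ (x∈X , y≡1) = subst (Eval X orc _) (trans (cong b2n x∈X) (sym y≡1)) ev-orc
    ... | inj₂ (x∉X , y≡0) = subst (Eval X orc _) (trans (cong b2n (Bool.¬-not x∉X)) (sym y≡0)) ev-orc
    graph-sound (comp {m = m} g hs) w xs y refl refl s with exs-elim m w (compBody g hs w xs y) s
    ... | vs , sₕ , s₉ =
      ev-comp (graphs-sound hs (wk m w) (wks m xs) (vars m) (⟦wks⟧ vs xs) (⟦vars⟧ vs) sₕ)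
              (graph-sound g (wk m w) (vars m) (wk m y) (⟦vars⟧ vs) (⟦wk⟧ vs y) s₉)
    graph-sound (prec g h) w (x ∷ xs) y {ρ} {v = v} refl refl s with exs-elim 2 w (precBody g h w x xs y) s
    ... | b ∷ a ∷ [] , ((u , _ , βu , su) , ss) , βy =
      let z , βz , ez = precStep-sound g h w x xs {a = a} {b} ss
                          (u , βF-elim {ρ = u ∷ b ∷ a ∷ ρ} v₂ v₁ tzero v₀ βu , graph-sound g (wk 3 w) (wks 3 xs) v₀
                                                             (⟦wks⟧ (u ∷ b ∷ a ∷ []) xs) refl su)
                          (⟦ x ⟧ ρ) ≤-refl
          βy′ = subst₂ (β a b) (⟦wk⟧ (b ∷ a ∷ []) x) (⟦wk⟧ (b ∷ a ∷ []) y)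
                  (βF-elim {ρ = b ∷ a ∷ ρ} v₁ v₀ (wk 2 x) (wk 2 y) βy)
      in subst (Eval X (prec g h) _) (β-functional a b (⟦ x ⟧ ρ) βz βy′) ez
    graph-sound (mu f) w xs y refl refl (s₀ , s₊) =
      ev-mu (graph-sound f w (y ∷ xs) tzero refl refl s₀)
            (λ z z<y → let u , _ , s = all-elim y (muBody f w xs) s₊ z z<y in
              u , graph-sound f (wk 2 w) (v₁ ∷ wks 2 xs) (tsuc v₀)
                    (cong (z ∷_) (⟦wks⟧ (u ∷ z ∷ []) xs)) refl s)

    -- Induction along the coded sequence. The entry at i found by the induction and the one named
    -- in the step formula agree by `β-functional`.
    precStep-sound : ∀ {k} (g : PR k) h {n} (w x : Term n) xs {ρ a b} →
      Sat X (precStep h w x xs) (b ∷ a ∷ ρ) →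
      (Σ ℕ λ u → β a b 0 u × Eval X g (⟦ xs ⟧* ρ) u) →
      ∀ i → i ≤ ⟦ x ⟧ ρ → Σ ℕ λ u → β a b i u × Eval X (prec g h) (i ∷ ⟦ xs ⟧* ρ) u
    precStep-sound g h w x xs ss (u , βu , eu) zero _ = u , βu , ev-prec0 eu
    precStep-sound g h w x xs {ρ} {a} {b} ss base (suc i) i<x
      with precStep-sound g h w x xs {ρ} {a} {b} ss base i (<⇒≤ i<x)
         | all-elim (wk 2 x) (exs 2 (wk 3 w) (stepBody h w xs)) ss i (subst (i <_) (sym (⟦wk⟧ (b ∷ a ∷ []) x)) i<x)
    ... | u , βu , eu | s with exs-elim 2 (wk 3 w) (stepBody h w xs) s
    ...   | v ∷ u′ ∷ [] , (βu′ , βv) , sh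
      with refl ← β-functional a b i βu (βF-elim {ρ = v ∷ u′ ∷ i ∷ b ∷ a ∷ ρ} v₄ v₃ v₂ v₁ βu′)
      = v , βF-elim {ρ = v ∷ u ∷ i ∷ b ∷ a ∷ ρ} v₄ v₃ (tsuc v₂) v₀ βv ,
        ev-precS eu (graph-sound h (wk 5 w) (v₂ ∷ v₁ ∷ wks 5 xs) v₀
          (cong (λ us → i ∷ u ∷ us) (⟦wks⟧ (v ∷ u ∷ i ∷ b ∷ a ∷ []) xs)) refl sh)

    graphs-sound : ∀ {k m} (hs : Vec (PR k) m) {n} (w : Term n) xs ys {ρ us vs} →
                   ⟦ xs ⟧* ρ ≡ us → ⟦ ys ⟧* ρ ≡ vs →
                   Sat X (graphs hs w xs ys) ρ → EvalAll X hs us vs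
    graphs-sound []       w xs []       refl refl _        = []
    graphs-sound (h ∷ hs) w xs (y ∷ ys) refl refl (s , ss) =
      graph-sound h w xs y refl refl s ∷ graphs-sound hs w xs ys refl refl ss

  -- The quantification over all contexts and terms lets an induction hypothesis be used below
  -- further quantifiers, and the threshold form lets several subcomputations share one `w`.
  Complete : ∀ {k} → PR k → Vec ℕ k → ℕ → ℕ → Set
  Complete f us v b = ∀ {n} {ρ : Vec ℕ n} w xs y → b ≤ ⟦ w ⟧ ρ → ⟦ xs ⟧* ρ ≡ us → ⟦ y ⟧ ρ ≡ v →
                      Sat X (graph f w xs y) ρ

  Complete-mono : ∀ {k} (f : PR k) {us v b c} → b ≤ c → Complete f us v b → Complete f us v c
  Complete-mono f b≤c s w xs y c≤w = s w xs y (≤-trans b≤c c≤w)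

  -- A derivation for `prec` unrolled into its course of values with a common threshold. The β-code
  -- needs the entire sequence at once, whereas `ev-precS` shows only the last step.
  data Computation {k} (g : PR k) (h : PR (2 + k)) (us : Vec ℕ k) (n y : ℕ) : Set where
    computation : ∀ b (z : ℕ → ℕ) → z n ≡ y → Complete g us (z 0) b →
                  (∀ i → i < n → Complete h (i ∷ z i ∷ us) (z (suc i)) b) →
                  Computation g h us n y

  module _ {k} {g : PR k} {h : PR (2 + k)} {us : Vec ℕ k} {n : ℕ} {z : ℕ → ℕ} {c a b M : ℕ}
           (cg : Complete g us (z 0) c) (ch : ∀ i → i < n → Complete h (i ∷ z i ∷ us) (z (suc i)) c)
           (βz : ∀ i → i < suc n → β a b i (z i)) (z≤M : ∀ i → i < suc n → z i ≤ M) where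

    base-complete : ∀ {m} {ρ : Vec ℕ m} w xs → c + suc M ≤ ⟦ w ⟧ ρ → ⟦ xs ⟧* ρ ≡ us →
                    Sat X (precBase g w xs) (b ∷ a ∷ ρ)
    base-complete {ρ = ρ} w xs bound≤w xs≡ =
      z 0 ,
      subst (z 0 <_) (sym (⟦wk⟧ (b ∷ a ∷ []) w)) (≤-trans (m≤n⇒m≤o+n c (s≤s (z≤M 0 (s≤s z≤n)))) bound≤w) ,
      βF-intro {ρ = z 0 ∷ b ∷ a ∷ ρ} v₂ v₁ tzero v₀ (βz 0 (s≤s z≤n)) ,
      cg (wk 3 w) (wks 3 xs) v₀
        (subst (c ≤_) (sym (⟦wk⟧ (z 0 ∷ b ∷ a ∷ []) w)) (≤-trans (m≤m+n c (suc M)) bound≤w))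
        (trans (⟦wks⟧ (z 0 ∷ b ∷ a ∷ []) xs) xs≡) refl

    step-complete : ∀ {m} {ρ : Vec ℕ m} w xs → c + suc M ≤ ⟦ w ⟧ ρ → ⟦ xs ⟧* ρ ≡ us → ∀ i → i < n →
                    Sat X (exs 2 (wk 3 w) (stepBody h w xs)) (i ∷ b ∷ a ∷ ρ)
    step-complete {ρ = ρ} w xs bound≤w xs≡ i i<n =
      exs-intro (wk 3 w) (stepBody h w xs) (z (suc i) ∷ z i ∷ []) (z<w (s≤s i<n) , z<w (m<n⇒m<1+n i<n) , tt)
        ( ( βF-intro {ρ = ρ′} v₄ v₃ v₂ v₁ (βz i (m<n⇒m<1+n i<n))
          , βF-intro {ρ = ρ′} v₄ v₃ (tsuc v₂) v₀ (βz (suc i) (s≤s i<n)))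
        , ch i i<n (wk 5 w) (v₂ ∷ v₁ ∷ wks 5 xs) v₀
            (subst (c ≤_) (sym (⟦wk⟧ vs w)) (≤-trans (m≤m+n c (suc M)) bound≤w))
            (cong (λ us → i ∷ z i ∷ us) (trans (⟦wks⟧ vs xs) xs≡)) refl)
      where
      vs = z (suc i) ∷ z i ∷ i ∷ b ∷ a ∷ []
      ρ′ = vs ++ᵛ ρ
      z<w : ∀ {j} → j < suc n → z j < ⟦ wk 3 w ⟧ (i ∷ b ∷ a ∷ ρ)
      z<w j≤n = subst (_ <_) (sym (⟦wk⟧ (i ∷ b ∷ a ∷ []) w))
        (≤-trans (m≤n⇒m≤o+n c (s≤s (z≤M _ j≤n))) bound≤w)

    -- The threshold makes room for the subcomputations (`c`), the entries of the sequence (at most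
    -- `M`) and the two numbers `a` and `b` that code it.
    prec-complete : Complete (prec g h) (n ∷ us) (z n) (c + suc M + (suc a + suc b))
    prec-complete {ρ = ρ} w (x ∷ xs) y bound≤w refl y≡ =
      exs-intro w (precBody g h w x xs y) (b ∷ a ∷ [])
        (≤-trans (m≤n⇒m≤o+n (c + suc M) (m≤n+m (suc b) (suc a))) bound≤w ,
         ≤-trans (m≤n⇒m≤o+n (c + suc M) (m≤m+n (suc a) (suc b))) bound≤w , tt)
        ( ( base-complete w xs c+M<w refl
          , all-intro (wk 2 x) (exs 2 (wk 3 w) (stepBody h w xs)) (λ i i<x →
              step-complete w xs c+M<w refl i (subst (i <_) (⟦wk⟧ (b ∷ a ∷ []) x) i<x)))
        , βF-intro {ρ = b ∷ a ∷ ρ} v₁ v₀ (wk 2 x) (wk 2 y)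
            (subst₂ (β a b) (sym (⟦wk⟧ (b ∷ a ∷ []) x)) (sym (trans (⟦wk⟧ (b ∷ a ∷ []) y) y≡)) (βz n ≤-refl)))
      where
      c+M<w : c + suc M ≤ ⟦ w ⟧ ρ
      c+M<w = ≤-trans (m≤m+n (c + suc M) (suc a + suc b)) bound≤w

  graph-complete-prec : ∀ {k} {g : PR k} {h us n y} → Computation g h us n y → Σ ℕ (Complete (prec g h) (n ∷ us) y)
  graph-complete-prec {n = n} (computation c z refl cg ch) =
    let a , b , βz = β-exists z (suc n)
        M , z≤M    = bounded-values z (suc n)
    in c + suc M + (suc a + suc b) , prec-complete cg ch βz z≤M

  mutual
    graph-complete : ∀ {k} {f : PR k} {us v} → Eval X f us v → Σ ℕ (Complete f us v)
    graph-complete ev-zer = 0 , λ { w xs y _ _ y≡ → y≡ }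
    graph-complete ev-succ = 0 , λ { w (x ∷ []) y _ refl y≡ → y≡ }
    graph-complete (ev-proj {i = i}) = 0 , λ { w xs y _ refl y≡ → trans y≡ (sym (⟦lookup⟧ xs i)) }
    graph-complete (ev-orc {x}) = 0 , complete
      where
      complete : Complete orc (x ∷ []) (b2n (X x)) 0
      complete w (t ∷ []) y _ refl y≡ =
        or-intro (andᶠ (memᶠ t) (eqᶠ y (tsuc tzero))) (andᶠ (negᶠ (memᶠ t)) (eqᶠ y tzero)) (cases refl y≡)
        where
        cases : ∀ {x b ρ} → X x ≡ b → ⟦ y ⟧ ρ ≡ b2n b →
                (X x ≡ true × ⟦ y ⟧ ρ ≡ 1) ⊎ (¬ X x ≡ true × ⟦ y ⟧ ρ ≡ 0)
        cases {b = true}  x∈X y≡ = inj₁ (x∈X , y≡)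
        cases {b = false} x∉X y≡ = inj₂ (Bool.not-¬ x∉X , y≡)
    graph-complete (ev-comp {g = g} {hs} {ys = vs} ds d) with graphs-complete ds | graph-complete d
    ... | b , vs<b , cs | c , s = b + c , λ w xs y b+c≤w xs≡ y≡ →
      exs-intro w (compBody g hs w xs y) vs (Bounded-mono (≤-trans (m≤m+n b c) b+c≤w) vs vs<b)
        ( cs (wk _ w) (wks _ xs) (vars _) (subst (b ≤_) (sym (⟦wk⟧ vs w)) (≤-trans (m≤m+n b c) b+c≤w))
            (trans (⟦wks⟧ vs xs) xs≡) (⟦vars⟧ vs)
        , s (wk _ w) (vars _) (wk _ y) (subst (c ≤_) (sym (⟦wk⟧ vs w)) (≤-trans (m≤n+m c b) b+c≤w))
            (⟦vars⟧ vs) (trans (⟦wk⟧ vs y) y≡))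
    graph-complete d@(ev-prec0 _) = graph-complete-prec (computation-of d)
    graph-complete d@(ev-precS _ _) = graph-complete-prec (computation-of d)
    graph-complete (ev-mu {f = f} {us} {v} d ds)
      with graph-complete d
         | uniform-bound (λ z b → Σ ℕ λ u → u < b × Complete f (z ∷ us) (suc u) b)
             (λ b≤c (u , u<b , s) → u , ≤-trans u<b b≤c , Complete-mono f b≤c s) v
             (λ z z<v → let b , s = graph-complete (proj₂ (ds z z<v)) ; u = proj₁ (ds z z<v) in
               suc u + b , u , m≤m+n (suc u) b , Complete-mono f (m≤n+m b (suc u)) s)
    ... | b , s₀ | c , s₊ = b + c , complete
      where
      complete : Complete (mu f) us v (b + c)
      complete {ρ = ρ} w xs y b+c≤w refl refl =
        s₀ w (y ∷ xs) tzero (≤-trans (m≤m+n b c) b+c≤w) refl refl ,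
        all-intro y (muBody f w xs) (λ z z<y → let u , u<c , s = s₊ z z<y in
          u , subst (u <_) (sym (⟦wk⟧ (z ∷ []) w)) (≤-trans u<c c≤w) ,
          s (wk 2 w) (v₁ ∷ wks 2 xs) (tsuc v₀) (subst (c ≤_) (sym (⟦wk⟧ (u ∷ z ∷ []) w)) c≤w)
            (cong (z ∷_) (⟦wks⟧ (u ∷ z ∷ []) xs)) refl)
        where
        c≤w : c ≤ ⟦ w ⟧ ρ
        c≤w = ≤-trans (m≤n+m c b) b+c≤w

    computation-of : ∀ {k} {g : PR k} {h n us y} → Eval X (prec g h) (n ∷ us) y → Computation g h us n y
    computation-of {y = y} (ev-prec0 d) with graph-complete d
    ... | b , s = computation b (λ _ → y) refl s (λ _ ())
    computation-of {g = g} {h} {suc n} {us} {y} (ev-precS d e) with computation-of d | graph-complete e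
    ... | computation b z refl cg ch | c , s =
      computation (b + c) z′ (extend-suc n z y)
        (subst (λ v → Complete g us v (b + c)) (sym (extend-≤ n z y z≤n)) (Complete-mono g (m≤m+n b c) cg))
        (λ i i<1+n → step i (m<1+n⇒m<n∨m≡n i<1+n))
      where
      z′ = extend n z y
      step : ∀ i → i < n ⊎ i ≡ n → Complete h (i ∷ z′ i ∷ us) (z′ (suc i)) (b + c)
      step i (inj₁ i<n) = subst₂ (λ u v → Complete h (i ∷ u ∷ us) v (b + c))
        (sym (extend-≤ n z y (<⇒≤ i<n))) (sym (extend-≤ n z y i<n)) (Complete-mono h (m≤m+n b c) (ch i i<n))
      step i (inj₂ refl) = subst₂ (λ u v → Complete h (i ∷ u ∷ us) v (b + c))
        (sym (extend-≤ n z y ≤-refl)) (sym (extend-suc n z y)) (Complete-mono h (m≤n+m c b) s)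

    graphs-complete : ∀ {k m} {hs : Vec (PR k) m} {us vs} → EvalAll X hs us vs →
      Σ ℕ λ b → Bounded b vs × (∀ {n} {ρ : Vec ℕ n} w xs ys → b ≤ ⟦ w ⟧ ρ → ⟦ xs ⟧* ρ ≡ us → ⟦ ys ⟧* ρ ≡ vs →
                                Sat X (graphs hs w xs ys) ρ)
    graphs-complete [] = 0 , tt , λ { w xs [] _ _ _ → refl }
    graphs-complete (_∷_ {y = v} {vs} d ds) with graph-complete d | graphs-complete ds
    ... | b , s | c , vs<c , ss =
      suc v + (b + c) ,
      (m≤m+n (suc v) (b + c) , Bounded-mono (m≤n⇒m≤o+n (suc v) (m≤n+m c b)) vs vs<c) ,
      λ { w xs (y ∷ ys) b≤w xs≡ refl →
            s w xs y (≤-trans (m≤n⇒m≤o+n (suc v) (m≤m+n b c)) b≤w) xs≡ refl ,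
            ss w xs ys (≤-trans (m≤n⇒m≤o+n (suc v) (m≤n+m c b)) b≤w) xs≡ refl }

-- Forcing bounded formulas

-- The set is queried only below this number. The existential case counts all candidates below the
-- bound, so that falsity is as local as truth.
use : ∀ {k} → BFormula k → Vec ℕ k → ℕ
use (eqᶠ t s) ρ  = 0
use (ltᶠ t s) ρ  = 0
use (memᶠ t) ρ   = suc (⟦ t ⟧ ρ)
use (andᶠ φ ψ) ρ = use φ ρ + use ψ ρ
use (negᶠ φ) ρ   = use φ ρ
use (exᶠ t φ) ρ  = proj₁ (bounded-values (λ v → use φ (v ∷ ρ)) (⟦ t ⟧ ρ))

use-ex : ∀ {k} (t : Term k) φ {ρ v} → v < ⟦ t ⟧ ρ → use φ (v ∷ ρ) ≤ use (exᶠ t φ) ρ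
use-ex t φ {ρ} = proj₂ (bounded-values (λ v → use φ (v ∷ ρ)) (⟦ t ⟧ ρ)) _

Sat-local : ∀ {k} {X Y : ℕ → Bool} (φ : BFormula k) {ρ} → (∀ n → n < use φ ρ → X n ≡ Y n) →
            Sat X φ ρ → Sat Y φ ρ
Sat-local (eqᶠ t s) X≡Y p = p
Sat-local (ltᶠ t s) X≡Y p = p
Sat-local (memᶠ t) X≡Y p = trans (sym (X≡Y _ ≤-refl)) p
Sat-local (andᶠ φ ψ) {ρ} X≡Y (p , q) =
  Sat-local φ (λ n n< → X≡Y n (m≤n⇒m≤n+o (use ψ ρ) n<)) p ,
  Sat-local ψ (λ n n< → X≡Y n (m≤n⇒m≤o+n (use φ ρ) n<)) q
Sat-local (negᶠ φ) X≡Y ¬p p = ¬p (Sat-local φ (λ n n< → sym (X≡Y n n<)) p)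
Sat-local (exᶠ t φ) X≡Y (v , v<t , p) =
  v , v<t , Sat-local φ (λ n n< → X≡Y n (≤-trans n< (use-ex t φ v<t))) p

infix 4 _⊑_ _⊏_

_⊑_ : Str → Str → Set
s ⊑ t = ∀ n b → bitAt s n ≡ just b → bitAt t n ≡ just b

_⊏_ : Str → (ℕ → Bool) → Set
s ⊏ X = ∀ n b → bitAt s n ≡ just b → X n ≡ b

pad : Str → ℕ → Bool
pad s n = fromMaybe false (bitAt s n)

⊏-pad : ∀ s → s ⊏ pad s
⊏-pad s n b eq rewrite eq = refl

bitAt-< : ∀ s n → n < length s → Σ Bool λ b → bitAt s n ≡ just b
bitAt-< (b ∷ s) zero    _         = b , refl
bitAt-< (b ∷ s) (suc n) (s≤s n<s) = bitAt-< s n n<s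

bitAt-just⇒< : ∀ s n {b} → bitAt s n ≡ just b → n < length s
bitAt-just⇒< (b ∷ s) zero    _  = s≤s z≤n
bitAt-just⇒< (b ∷ s) (suc n) eq = s≤s (bitAt-just⇒< s n eq)

⊏-agree : ∀ s t {X Y N} → s ⊑ t → s ⊏ X → t ⊏ Y → N ≤ length s → ∀ n → n < N → X n ≡ Y n
⊏-agree s t s⊑t s⊏X t⊏Y N≤s n n<N with bitAt-< s n (≤-trans n<N N≤s)
... | b , eq = trans (s⊏X n b eq) (sym (t⊏Y n b (s⊑t n b eq)))

⊑-length : ∀ s t → s ⊑ t → length s ≤ length t
⊑-length [] t s⊑t = z≤n
⊑-length (b ∷ s) t s⊑t with bitAt-< (b ∷ s) (length s) ≤-refl
... | b′ , eq = bitAt-just⇒< t (length s) (s⊑t (length s) b′ eq)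

-- `product` gives raw data only; these are the laws on which the comparison of forcing with truth
-- rests.
record IsMonotoneOrder (D : ForcingData) : Set where
  open ForcingData D
  field
    reflexive  : ∀ p → P p ≡ true → le p p ≡ true
    transitive : ∀ p q r → P p ≡ true → P q ≡ true → P r ≡ true →
                 le p q ≡ true → le q r ≡ true → le p r ≡ true
    monotone   : ∀ p q → P p ≡ true → P q ≡ true → le q p ≡ true → V p ⊑ V q

module Forcing-Δ₀ (D : ForcingData) (isMonotoneOrder : IsMonotoneOrder D) where
  open ForcingData D
  open IsMonotoneOrder isMonotoneOrder

  mutual
    -- A valuation at least as long as the use settles every queried bit, and then forcing and truth
    -- agree. For a negation each direction needs the other for the negated formula: here `p` is
    -- taken as its own extension.
    Forces⇒Sat : ∀ {k} {X p} (φ : BFormula k) {ρ} → P p ≡ true → V p ⊏ X → use φ ρ ≤ length (V p) →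
                 Forces D p ⌊ φ ⌋ ρ → Sat X φ ρ
    Forces⇒Sat (eqᶠ t s) Pp V⊏X u f = f
    Forces⇒Sat (ltᶠ t s) Pp V⊏X u f = f
    Forces⇒Sat (memᶠ t) Pp V⊏X u f = V⊏X _ _ f
    Forces⇒Sat (andᶠ φ ψ) {ρ} Pp V⊏X u (f , g) =
      Forces⇒Sat φ Pp V⊏X (m+n≤o⇒m≤o (use φ ρ) u) f , Forces⇒Sat ψ Pp V⊏X (m+n≤o⇒n≤o (use φ ρ) u) g
    Forces⇒Sat {p = p} (negᶠ φ) Pp V⊏X u f s = f p Pp (reflexive p Pp) (Sat⇒Forces φ Pp V⊏X u s)
    Forces⇒Sat (exᶠ t φ) {ρ} Pp V⊏X u (v , v<t , f) = v , v<t′ , Forces⇒Sat φ Pp V⊏X (≤-trans (use-ex t φ v<t′) u) f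
      where
      v<t′ : v < ⟦ t ⟧ ρ
      v<t′ = subst (v <_) (⟦wkT⟧ t) v<t

    Sat⇒Forces : ∀ {k} {X p} (φ : BFormula k) {ρ} → P p ≡ true → V p ⊏ X → use φ ρ ≤ length (V p) →
                 Sat X φ ρ → Forces D p ⌊ φ ⌋ ρ
    Sat⇒Forces (eqᶠ t s) Pp V⊏X u f = f
    Sat⇒Forces (ltᶠ t s) Pp V⊏X u f = f
    Sat⇒Forces {p = p} (memᶠ t) {ρ} Pp V⊏X u t∈X with bitAt-< (V p) (⟦ t ⟧ ρ) u
    ... | b , eq = trans eq (cong just (trans (sym (V⊏X _ b eq)) t∈X))
    Sat⇒Forces (andᶠ φ ψ) {ρ} Pp V⊏X u (f , g) =
      Sat⇒Forces φ Pp V⊏X (m+n≤o⇒m≤o (use φ ρ) u) f , Sat⇒Forces ψ Pp V⊏X (m+n≤o⇒n≤o (use φ ρ) u) g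
    -- The set `X` need not extend `V q`. Truth is therefore tested at `V q` padded with zeros,
    -- which agrees with `X` below the use since both extend `V p`.
    Sat⇒Forces {p = p} (negᶠ φ) Pp V⊏X u ¬s q Pq q≤p f =
      ¬s (Sat-local φ (λ n n<u → sym (⊏-agree (V p) (V q) p⊑q V⊏X (⊏-pad (V q)) u n n<u))
        (Forces⇒Sat φ Pq (⊏-pad (V q)) (≤-trans u (⊑-length (V p) (V q) p⊑q)) f))
      where
      p⊑q : V p ⊑ V q
      p⊑q = monotone p q Pp Pq q≤p
    Sat⇒Forces (exᶠ t φ) Pp V⊏X u (v , v<t , f) =
      v , subst (v <_) (sym (⟦wkT⟧ t)) v<t , Sat⇒Forces φ Pp V⊏X (≤-trans (use-ex t φ v<t) u) f

  Forces-mono : ∀ {k p q} (φ : BFormula k) {ρ} → P p ≡ true → P q ≡ true → le q p ≡ true →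
                Forces D p ⌊ φ ⌋ ρ → Forces D q ⌊ φ ⌋ ρ
  Forces-mono (eqᶠ t s) Pp Pq q≤p f = f
  Forces-mono (ltᶠ t s) Pp Pq q≤p f = f
  Forces-mono {p = p} {q} (memᶠ t) Pp Pq q≤p f = monotone p q Pp Pq q≤p _ _ f
  Forces-mono (andᶠ φ ψ) Pp Pq q≤p (f , g) = Forces-mono φ Pp Pq q≤p f , Forces-mono ψ Pp Pq q≤p g
  Forces-mono {p = p} {q} (negᶠ φ) Pp Pq q≤p f r Pr r≤q = f r Pr (transitive r q p Pr Pq Pp r≤q q≤p)
  Forces-mono (exᶠ t φ) Pp Pq q≤p (v , v<t , f) = v , v<t , Forces-mono φ Pp Pq q≤p f

-- Programs for total functions

natrec : ℕ → (ℕ → ℕ → ℕ) → ℕ → ℕ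
natrec z s zero    = z
natrec z s (suc n) = s n (natrec z s n)

-- Bounded quantifiers for zero tests: a sum vanishes if all terms do, a product if some factor
-- does.
∑< ∏< : ℕ → (ℕ → ℕ) → ℕ
∑< n f = natrec 0 (λ i z → z + f i) n
∏< n f = natrec 1 (λ i z → z * f i) n

∑<≡0⇒ : ∀ n {f} → ∑< n f ≡ 0 → ∀ i → i < n → f i ≡ 0
∑<≡0⇒ (suc n) {f} eq i i<1+n with m<1+n⇒m<n∨m≡n i<1+n
... | inj₁ i<n  = ∑<≡0⇒ n (m+n≡0⇒m≡0 (∑< n f) eq) i i<n
... | inj₂ refl = m+n≡0⇒n≡0 (∑< n f) eq

⇒∑<≡0 : ∀ n {f} → (∀ i → i < n → f i ≡ 0) → ∑< n f ≡ 0
⇒∑<≡0 zero    f≡0 = refl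
⇒∑<≡0 (suc n) f≡0 = cong₂ _+_ (⇒∑<≡0 n (λ i i<n → f≡0 i (m<n⇒m<1+n i<n))) (f≡0 n ≤-refl)

∏<≡0⇒ : ∀ n {f} → ∏< n f ≡ 0 → Σ ℕ λ i → i < n × f i ≡ 0
∏<≡0⇒ (suc n) {f} eq with m*n≡0⇒m≡0∨n≡0 (∏< n f) eq
... | inj₂ fn≡0 = n , ≤-refl , fn≡0
... | inj₁ eq′ with ∏<≡0⇒ n eq′
...   | i , i<n , fi≡0 = i , m<n⇒m<1+n i<n , fi≡0

⇒∏<≡0 : ∀ n {f} i → i < n → f i ≡ 0 → ∏< n f ≡ 0
⇒∏<≡0 (suc n) {f} i i<1+n fi≡0 with m<1+n⇒m<n∨m≡n i<1+n
... | inj₁ i<n  = cong (_* f n) (⇒∏<≡0 n i i<n fi≡0)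
... | inj₂ refl = trans (cong (∏< n f *_) fi≡0) (*-zeroʳ (∏< n f))

dist : ℕ → ℕ → ℕ
dist x y = (x ∸ y) + (y ∸ x)

dist≡0⇒≡ : ∀ x y → dist x y ≡ 0 → x ≡ y
dist≡0⇒≡ x y eq = ≤-antisym (m∸n≡0⇒m≤n (m+n≡0⇒m≡0 (x ∸ y) eq)) (m∸n≡0⇒m≤n (m+n≡0⇒n≡0 (x ∸ y) eq))

≡⇒dist≡0 : ∀ {x y} → x ≡ y → dist x y ≡ 0
≡⇒dist≡0 {x} refl = cong₂ _+_ (n∸n≡0 x) (n∸n≡0 x)

-- Truth values are coded by zero tests: "true" is 0 and "false" is any positive number.
isZero : ℕ → Bool
isZero zero    = true
isZero (suc _) = false

isZero⇒ : ∀ n → isZero n ≡ true → n ≡ 0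
isZero⇒ zero _ = refl

⇒isZero : ∀ {n} → n ≡ 0 → isZero n ≡ true
⇒isZero refl = refl

isZero-b2n : ∀ n → 1 ∸ n ≡ b2n (isZero n)
isZero-b2n zero    = refl
isZero-b2n (suc n) = 0∸n≡0 n

module Computability (A : ℕ → Bool) where

  -- Functions of an environment, in which expressions in the variables `x₀`, `x₁`, ... are
  -- composed; the curried versions below are for named functions that get applied.
  Rep : ∀ {k} → (Vec ℕ k → ℕ) → Set
  Rep {k} f = Σ (PR k) λ c → ∀ ρ → Eval A c ρ (f ρ)

  Rep₁ : (ℕ → ℕ) → Set
  Rep₁ f = Σ (PR 1) λ c → ∀ x → Eval A c (x ∷ []) (f x)

  Rep₂ : (ℕ → ℕ → ℕ) → Set
  Rep₂ f = Σ (PR 2) λ c → ∀ x y → Eval A c (x ∷ y ∷ []) (f x y)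

  Rep₃ : (ℕ → ℕ → ℕ → ℕ) → Set
  Rep₃ f = Σ (PR 3) λ c → ∀ x y z → Eval A c (x ∷ y ∷ z ∷ []) (f x y z)

  Rep₄ : (ℕ → ℕ → ℕ → ℕ → ℕ) → Set
  Rep₄ f = Σ (PR 4) λ c → ∀ x y z u → Eval A c (x ∷ y ∷ z ∷ u ∷ []) (f x y z u)

  Rep₁-≗ : ∀ {f g} → Rep₁ f → (∀ x → f x ≡ g x) → Rep₁ g
  Rep₁-≗ (c , ev) f≡g = c , λ x → subst (Eval A c _) (f≡g x) (ev x)

  Rep₂-≗ : ∀ {f g} → Rep₂ f → (∀ x y → f x y ≡ g x y) → Rep₂ g
  Rep₂-≗ (c , ev) f≡g = c , λ x y → subst (Eval A c _) (f≡g x y) (ev x y)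

  fun₁ : ∀ {f} → Rep {1} f → Rep₁ (λ x → f (x ∷ []))
  fun₁ (c , ev) = c , λ x → ev _

  fun₂ : ∀ {f} → Rep {2} f → Rep₂ (λ x y → f (x ∷ y ∷ []))
  fun₂ (c , ev) = c , λ x y → ev _

  fun₃ : ∀ {f} → Rep {3} f → Rep₃ (λ x y z → f (x ∷ y ∷ z ∷ []))
  fun₃ (c , ev) = c , λ x y z → ev _

  fun₄ : ∀ {f} → Rep {4} f → Rep₄ (λ x y z u → f (x ∷ y ∷ z ∷ u ∷ []))
  fun₄ (c , ev) = c , λ x y z u → ev _

  module _ {k : ℕ} where
    app₁ : ∀ {f} {e : Vec ℕ k → ℕ} → Rep₁ f → Rep e → Rep (λ ρ → f (e ρ))
    app₁ (c , ev) (d , ed) = comp c (d ∷ []) , λ ρ → ev-comp (ed ρ ∷ []) (ev _)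

    app₂ : ∀ {f} {e₁ e₂ : Vec ℕ k → ℕ} → Rep₂ f → Rep e₁ → Rep e₂ → Rep (λ ρ → f (e₁ ρ) (e₂ ρ))
    app₂ (c , ev) (d , ed) (d′ , ed′) =
      comp c (d ∷ d′ ∷ []) , λ ρ → ev-comp (ed ρ ∷ ed′ ρ ∷ []) (ev _ _)

    app₃ : ∀ {f} {e₁ e₂ e₃ : Vec ℕ k → ℕ} → Rep₃ f → Rep e₁ → Rep e₂ → Rep e₃ →
           Rep (λ ρ → f (e₁ ρ) (e₂ ρ) (e₃ ρ))
    app₃ (c , ev) (d , ed) (d′ , ed′) (d″ , ed″) =
      comp c (d ∷ d′ ∷ d″ ∷ []) , λ ρ → ev-comp (ed ρ ∷ ed′ ρ ∷ ed″ ρ ∷ []) (ev _ _ _)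

    app₄ : ∀ {f} {e₁ e₂ e₃ e₄ : Vec ℕ k → ℕ} → Rep₄ f → Rep e₁ → Rep e₂ → Rep e₃ → Rep e₄ →
           Rep (λ ρ → f (e₁ ρ) (e₂ ρ) (e₃ ρ) (e₄ ρ))
    app₄ (c , ev) (d , ed) (d′ , ed′) (d″ , ed″) (d‴ , ed‴) =
      comp c (d ∷ d′ ∷ d″ ∷ d‴ ∷ []) , λ ρ → ev-comp (ed ρ ∷ ed′ ρ ∷ ed″ ρ ∷ ed‴ ρ ∷ []) (ev _ _ _ _)

    arg : (i : Fin k) → Rep (λ ρ → lookup ρ i)
    arg i = proj i , λ ρ → ev-proj

    sucR : ∀ {e : Vec ℕ k → ℕ} → Rep e → Rep (λ ρ → suc (e ρ))
    sucR = app₁ (succ , λ x → ev-succ)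

    const : ∀ n → Rep {k} (λ _ → n)
    const zero    = zer , λ ρ → ev-zer
    const (suc n) = sucR (const n)

    projections : ∀ {m} → (Fin m → Fin k) → Vec (PR k) m
    projections ι = tabulate (λ i → proj (ι i))

    projections-eval : ∀ {m} (ι : Fin m → Fin k) ρ →
                       EvalAll A (projections ι) ρ (tabulate (λ i → lookup ρ (ι i)))
    projections-eval {zero}  ι ρ = []
    projections-eval {suc m} ι ρ = ev-proj ∷ projections-eval (λ i → ι (suc i)) ρ

    recR : ∀ {g e : Vec ℕ k → ℕ} {h} → Rep g → Rep {2 + k} h → Rep e →
           Rep (λ ρ → natrec (g ρ) (λ n z → h (n ∷ z ∷ ρ)) (e ρ))
    recR {g} {e} {h} (c , ec) (d , ed) (b , eb) =
      comp (prec c d) (b ∷ projections (λ i → i)) ,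
      λ ρ → ev-comp (eb ρ ∷ subst (EvalAll A _ ρ) (tabulate∘lookup ρ) (projections-eval (λ i → i) ρ)) (loop ρ (e ρ))
      where
      loop : ∀ ρ n → Eval A (prec c d) (n ∷ ρ) (natrec (g ρ) (λ n z → h (n ∷ z ∷ ρ)) n)
      loop ρ zero    = ev-prec0 (ec ρ)
      loop ρ (suc n) = ev-precS (loop ρ n) (ed _)

    muR : ∀ {t} {v : Vec ℕ k → ℕ} → Rep {suc k} t → (∀ ρ → t (v ρ ∷ ρ) ≡ 0) →
          (∀ ρ z → z < v ρ → ¬ t (z ∷ ρ) ≡ 0) → Rep v
    muR {t} {v} (c , ec) zeroAt nonzeroBelow = mu c , λ ρ →
      ev-mu (subst (Eval A c _) (zeroAt ρ) (ec _))
            (λ z z<v → pred (t (z ∷ ρ)) , subst (Eval A c _) (sym (nonzero ρ z z<v)) (ec _))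
      where
      nonzero : ∀ ρ z → z < v ρ → suc (pred (t (z ∷ ρ))) ≡ t (z ∷ ρ)
      nonzero ρ z z<v with t (z ∷ ρ) | nonzeroBelow ρ z z<v
      ... | zero  | t≢0 = contradiction refl t≢0
      ... | suc _ | _   = refl

  x₀ : ∀ {k} → Rep {suc k} (λ ρ → lookup ρ zero)
  x₀ = arg zero
  x₁ : ∀ {k} → Rep {2 + k} (λ ρ → lookup ρ (suc zero))
  x₁ = arg (suc zero)
  x₂ : ∀ {k} → Rep {3 + k} (λ ρ → lookup ρ (suc (suc zero)))
  x₂ = arg (suc (suc zero))
  x₃ : ∀ {k} → Rep {4 + k} (λ ρ → lookup ρ (suc (suc (suc zero))))
  x₃ = arg (suc (suc (suc zero)))

  +R : Rep₂ _+_
  +R = Rep₂-≗ (fun₂ (recR x₁ (sucR x₁) x₀)) rec≡+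
    where
    rec≡+ : ∀ x y → natrec y (λ _ z → suc z) x ≡ x + y
    rec≡+ zero    y = refl
    rec≡+ (suc x) y = cong suc (rec≡+ x y)

  *R : Rep₂ _*_
  *R = Rep₂-≗ (fun₂ (recR (const 0) (app₂ +R x₃ x₁) x₀)) rec≡*
    where
    rec≡* : ∀ x y → natrec 0 (λ _ z → y + z) x ≡ x * y
    rec≡* zero    y = refl
    rec≡* (suc x) y = cong (y +_) (rec≡* x y)

  predR : Rep₁ pred
  predR = Rep₁-≗ (fun₁ (recR (const 0) x₀ x₀)) λ { zero → refl ; (suc x) → refl }

  ∸R : Rep₂ _∸_
  ∸R = Rep₂-≗ (fun₂ (recR x₀ (app₁ predR x₁) x₁)) rec≡∸
    where
    rec≡∸ : ∀ x y → natrec x (λ _ z → pred z) y ≡ x ∸ y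
    rec≡∸ x zero    = refl
    rec≡∸ x (suc y) = trans (cong pred (rec≡∸ x y)) (pred[m∸n]≡m∸[1+n] x y)

  2^R : Rep₁ (2 ^_)
  2^R = Rep₁-≗ (fun₁ (recR (const 1) (app₂ *R (const 2) x₁) x₀)) rec≡2^
    where
    rec≡2^ : ∀ x → natrec 1 (λ _ z → 2 * z) x ≡ 2 ^ x
    rec≡2^ zero    = refl
    rec≡2^ (suc x) = cong (2 *_) (rec≡2^ x)

  distR : Rep₂ dist
  distR = fun₂ (app₂ +R (app₂ ∸R x₀ x₁) (app₂ ∸R x₁ x₀))

  module _ {k : ℕ} {e : Vec ℕ k → ℕ} {f : Vec ℕ (suc k) → ℕ} where
    private
      shift : Rep f → Rep {2 + k} (λ { (i ∷ z ∷ ρ) → f (i ∷ ρ) })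
      shift (c , ev) = comp c (proj zero ∷ projections (λ i → suc (suc i))) , λ { (i ∷ z ∷ ρ) →
        ev-comp (ev-proj ∷ subst (EvalAll A _ _) (tabulate∘lookup ρ)
                             (projections-eval (λ i → suc (suc i)) (i ∷ z ∷ ρ))) (ev _) }

    ∑R : Rep e → Rep f → Rep (λ ρ → ∑< (e ρ) (λ i → f (i ∷ ρ)))
    ∑R re rf = recR (const 0) (app₂ +R x₁ (shift rf)) re

    ∏R : Rep e → Rep f → Rep (λ ρ → ∏< (e ρ) (λ i → f (i ∷ ρ)))
    ∏R re rf = recR (const 1) (app₂ *R x₁ (shift rf)) re

  isZeroR : Rep₁ (λ n → b2n (isZero n))
  isZeroR = Rep₁-≗ (fun₁ (app₂ ∸R (const 1) x₀)) isZero-b2n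

-- Codes of pairs and strings

triangle : ℕ → ℕ
triangle = natrec 0 (λ n t → suc n + t)

fst snd : ℕ → ℕ
fst n = proj₁ (unpair n)
snd n = proj₂ (unpair n)

opaque
  -- Closed form of the inverse of `unpair`: the enumeration runs through the diagonals of constant
  -- a + b = k, and (0 , k) has index `triangle k`.
  pair : ℕ → ℕ → ℕ
  pair a b = a + triangle (a + b)

  unpair-pair : ∀ a b → unpair (pair a b) ≡ (a , b)
  unpair-pair a b = go (a + b) a b refl
    where
    go : ∀ k a b → a + b ≡ k → unpair (a + triangle k) ≡ (a , b)
    go zero    zero    zero    _    = refl
    go (suc k) zero    (suc .k) refl = cong nextPair (go k k 0 (+-identityʳ k))
    go k       (suc a) b       a+b≡k = cong nextPair (go k a (suc b) (trans (+-suc a b) a+b≡k))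

  pair-unpair : ∀ n → pair (fst n) (snd n) ≡ n
  pair-unpair zero = refl
  pair-unpair (suc n) with unpair n | pair-unpair n
  ... | a , zero  | refl = cong (λ k → suc (a + triangle k)) (sym (+-identityʳ a))
  ... | a , suc b | refl = cong (λ k → suc (a + triangle k)) (sym (+-suc a b))

  a≤pair : ∀ a b → a ≤ pair a b
  a≤pair a b = m≤m+n a _

  n≤triangle : ∀ n → n ≤ triangle n
  n≤triangle zero    = z≤n
  n≤triangle (suc n) = s≤s (m≤m+n n (triangle n))

  b≤pair : ∀ a b → b ≤ pair a b
  b≤pair a b = ≤-trans (m≤n+m b a) (≤-trans (n≤triangle (a + b)) (m≤n+m _ a))

fst-pair : ∀ a b → fst (pair a b) ≡ a
fst-pair a b = cong proj₁ (unpair-pair a b)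

snd-pair : ∀ a b → snd (pair a b) ≡ b
snd-pair a b = cong proj₂ (unpair-pair a b)

-- The largest k with `triangle k` at most n, by counting: the increment is 1 exactly when n + 1
-- reaches the next triangular number.
diagonal : ℕ → ℕ
diagonal = natrec 0 (λ n k → k + (1 ∸ (triangle (suc k) ∸ suc n)))

opaque
  unfolding pair

  diagonal-unpair : ∀ n → diagonal n ≡ fst n + snd n
  diagonal-unpair zero = refl
  diagonal-unpair (suc n) rewrite diagonal-unpair n with unpair n | pair-unpair n
  ... | a , zero  | refl rewrite +-identityʳ a | n∸n≡0 (a + triangle a) = +-comm a 1
  ... | a , suc b | refl = begin
    a + suc b + (1 ∸ (a + suc b + triangle (a + suc b) ∸ (a + triangle (a + suc b))))
      ≡⟨ cong (λ z → a + suc b + (1 ∸ (z ∸ (a + triangle (a + suc b)))))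
           (solve 3 (λ a b t → a :+ b :+ t := b :+ (a :+ t)) refl a (suc b) (triangle (a + suc b))) ⟩
    a + suc b + (1 ∸ (suc b + (a + triangle (a + suc b)) ∸ (a + triangle (a + suc b))))
      ≡⟨ cong (λ z → a + suc b + (1 ∸ z)) (m+n∸n≡m (suc b) (a + triangle (a + suc b))) ⟩
    a + suc b + (0 ∸ b)
      ≡⟨ cong (a + suc b +_) (0∸n≡0 b) ⟩
    a + suc b + 0
      ≡⟨ solve 2 (λ a b → a :+ (con 1 :+ b) :+ con 0 := con 1 :+ a :+ b) refl a b ⟩
    suc a + b ∎
    where
    open ≡-Reasoning
    open +-*-Solver using (solve; _:+_; _:=_; con)

  fst-formula : ∀ n → n ∸ triangle (diagonal n) ≡ fst n
  fst-formula n rewrite diagonal-unpair n = begin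
    n ∸ triangle (fst n + snd n)                        ≡⟨ cong (_∸ triangle (fst n + snd n)) (pair-unpair n) ⟨
    pair (fst n) (snd n) ∸ triangle (fst n + snd n)     ≡⟨ m+n∸n≡m (fst n) (triangle (fst n + snd n)) ⟩
    fst n ∎
    where open ≡-Reasoning

snd-formula : ∀ n → diagonal n ∸ fst n ≡ snd n
snd-formula n = trans (cong (_∸ fst n) (diagonal-unpair n)) (m+n∸m≡n (fst n) (snd n))

-- Strings in bijective base 2

double-suc : ∀ n → 2 * suc n ≡ suc (suc (2 * n))
double-suc n = *-suc 2 n

decStr-odd : ∀ n → decStr (1 + 2 * n) ≡ false ∷ decStr n
decStr-odd zero = refl
decStr-odd (suc n) = trans (cong (λ z → decStr (suc z)) (double-suc n)) (cong (λ s → incStr (incStr s)) (decStr-odd n))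

decStr-encStr : ∀ s → decStr (encStr s) ≡ s
decStr-encStr []          = refl
decStr-encStr (false ∷ s) = trans (decStr-odd (encStr s)) (cong (false ∷_) (decStr-encStr s))
decStr-encStr (true ∷ s)  = trans (cong incStr (decStr-odd (encStr s))) (cong (true ∷_) (decStr-encStr s))

encStr-incStr : ∀ s → encStr (incStr s) ≡ suc (encStr s)
encStr-incStr []          = refl
encStr-incStr (false ∷ s) = refl
encStr-incStr (true ∷ s)  = cong suc (trans (cong (2 *_) (encStr-incStr s)) (double-suc (encStr s)))

encStr-decStr : ∀ n → encStr (decStr n) ≡ n
encStr-decStr zero    = refl
encStr-decStr (suc n) = trans (encStr-incStr (decStr n)) (cong suc (encStr-decStr n))

encStr-++ : ∀ s t → encStr (s ++ t) ≡ encStr s + 2 ^ length s * encStr t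
encStr-++ [] t = sym (+-identityʳ (encStr t))
encStr-++ (b ∷ s) t = trans (digit b) (cong (λ z → encStr (b ∷ s) + z) (sym (*-assoc 2 (2 ^ length s) (encStr t))))
  where
  open ≡-Reasoning
  double : 2 * encStr (s ++ t) ≡ 2 * encStr s + 2 * (2 ^ length s * encStr t)
  double = trans (cong (2 *_) (encStr-++ s t)) (*-distribˡ-+ 2 (encStr s) _)
  digit : ∀ b → encStr (b ∷ s ++ t) ≡ encStr (b ∷ s) + 2 * (2 ^ length s * encStr t)
  digit false = cong suc double
  digit true  = cong (λ z → suc (suc z)) double

-- the leading digit of the bijective base-2 expansion, with 0 for the empty string
digit : ℕ → ℕ
digit = natrec 0 (λ _ d → suc (d * (2 ∸ d)))

-- Removal of the first bit: 1 + 2 n and 2 + 2 n both go to n, so the value grows exactly after a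
-- number with digit 2.
halve : ℕ → ℕ
halve = natrec 0 (λ n t → t + (digit n ∸ 1))

digit-odd : ∀ n → digit (1 + 2 * n) ≡ 1
digit-odd zero = refl
digit-odd (suc n) = trans (cong (λ z → digit (suc z)) (double-suc n))
  (cong (λ d → next (next d)) (digit-odd n))
  where
  next : ℕ → ℕ
  next d = suc (d * (2 ∸ d))

halve-odd : ∀ n → halve (1 + 2 * n) ≡ n
halve-even : ∀ n → halve (2 + 2 * n) ≡ n
halve-odd zero = refl
halve-odd (suc n) = trans (cong (λ z → halve (suc z)) (double-suc n))
  (trans (cong₂ (λ h d → h + (suc (d * (2 ∸ d)) ∸ 1)) (halve-even n) (digit-odd n)) (+-comm n 1))
halve-even n = trans (cong₂ (λ h d → h + (d ∸ 1)) (halve-odd n) (digit-odd n)) (+-identityʳ n)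

halve-encStr : ∀ s → halve (encStr s) ≡ encStr (drop 1 s)
halve-encStr []          = refl
halve-encStr (false ∷ s) = halve-odd (encStr s)
halve-encStr (true ∷ s)  = halve-even (encStr s)

drop-suc : ∀ {A : Set} i (s : List A) → drop (suc i) s ≡ drop 1 (drop i s)
drop-suc zero    s       = refl
drop-suc (suc i) []      = refl
drop-suc (suc i) (x ∷ s) = drop-suc i s

bitCode : Maybe Bool → ℕ
bitCode nothing      = 0
bitCode (just false) = 1
bitCode (just true)  = 2

bitCode-injective : ∀ x y → bitCode x ≡ bitCode y → x ≡ y
bitCode-injective nothing      nothing      _ = refl
bitCode-injective (just false) (just false) _ = refl
bitCode-injective (just true)  (just true)  _ = refl
bitCode-injective nothing      (just false) ()
bitCode-injective nothing      (just true)  ()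
bitCode-injective (just false) nothing      ()
bitCode-injective (just true)  nothing      ()
bitCode-injective (just false) (just true)  ()
bitCode-injective (just true)  (just false) ()

digit-drop : ∀ i s → digit (encStr (drop i s)) ≡ bitCode (bitAt s i)
digit-drop zero    []          = refl
digit-drop zero    (false ∷ s) = digit-odd (encStr s)
digit-drop zero    (true ∷ s)  = cong (λ d → suc (d * (2 ∸ d))) (digit-odd (encStr s))
digit-drop (suc i) []          = refl
digit-drop (suc i) (b ∷ s)     = digit-drop i s

dropCode : ℕ → ℕ → ℕ
dropCode i a = encStr (drop i (decStr a))

dropCode-rec : ∀ i a → natrec a (λ _ → halve) i ≡ dropCode i a
dropCode-rec zero    a = sym (encStr-decStr a)
dropCode-rec (suc i) a = begin
  halve (natrec a (λ _ → halve) i)     ≡⟨ cong halve (dropCode-rec i a) ⟩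
  halve (encStr (drop i (decStr a)))   ≡⟨ halve-encStr (drop i (decStr a)) ⟩
  encStr (drop 1 (drop i (decStr a)))  ≡⟨ cong encStr (drop-suc i (decStr a)) ⟨
  encStr (drop (suc i) (decStr a)) ∎
  where open ≡-Reasoning

lengthCode : ℕ → ℕ
lengthCode a = length (decStr a)

encStr-drop≡0 : ∀ {s} → encStr (drop (length s) s) ≡ 0
encStr-drop≡0 {[]}    = refl
encStr-drop≡0 {b ∷ s} = encStr-drop≡0 {s}

encStr-drop≢0 : ∀ s i → i < length s → ¬ encStr (drop i s) ≡ 0
encStr-drop≢0 (false ∷ s) zero    _         ()
encStr-drop≢0 (true ∷ s)  zero    _         ()
encStr-drop≢0 (b ∷ s)     (suc i) (s≤s i<s) = encStr-drop≢0 s i i<s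

-- With `encStr-upper`: the strings of length m have the codes from 2^m - 1 to 2^(m+1) - 2, which is
-- where `nthCode` comes from.
encStr-lower : ∀ s → 2 ^ length s ≤ suc (encStr s)
encStr-lower [] = ≤-refl
encStr-lower (false ∷ s) = subst (2 ^ suc (length s) ≤_) (double-suc (encStr s)) (*-monoʳ-≤ 2 (encStr-lower s))
encStr-lower (true ∷ s)  = m≤n⇒m≤1+n (subst (2 ^ suc (length s) ≤_) (double-suc (encStr s)) (*-monoʳ-≤ 2 (encStr-lower s)))

encStr-upper : ∀ s → suc (suc (encStr s)) ≤ 2 ^ suc (length s)
encStr-upper [] = ≤-refl
encStr-upper (b ∷ s) = ≤-trans (digit≤ b) (subst (_≤ 2 ^ suc (suc (length s)))
  (trans (double-suc (suc (encStr s))) (cong (λ z → suc (suc z)) (double-suc (encStr s))))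
  (*-monoʳ-≤ 2 (encStr-upper s)))
  where
  digit≤ : ∀ b → suc (suc (encStr (b ∷ s))) ≤ suc (suc (suc (suc (2 * encStr s))))
  digit≤ false = n≤1+n _
  digit≤ true  = ≤-refl

-- for j < 2 ^ m, the j-th string of length m
nthCode : ℕ → ℕ → ℕ
nthCode m j = pred (2 ^ m + j)

nthStr : ℕ → ℕ → Str
nthStr m j = decStr (nthCode m j)

suc-nthCode : ∀ m j → suc (nthCode m j) ≡ 2 ^ m + j
suc-nthCode m j = suc-pred (2 ^ m + j) {{>-nonZero (≤-trans (m^n>0 2 m) (m≤m+n (2 ^ m) j))}}

length-nthStr : ∀ m j → j < 2 ^ m → length (nthStr m j) ≡ m
length-nthStr m j j<2^m = length≡ (nthStr m j) (trans (cong suc (encStr-decStr (nthCode m j))) (suc-nthCode m j))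
  where
  length≡ : ∀ s → suc (encStr s) ≡ 2 ^ m + j → length s ≡ m
  length≡ s eq with <-cmp (length s) m
  ... | tri≈ _ s≡m _ = s≡m
  ... | tri< s<m _ _ = contradiction
    (≤-trans (s≤s (subst (2 ^ m ≤_) (sym eq) (m≤m+n (2 ^ m) j)))
      (≤-trans (encStr-upper s) (^-monoʳ-≤ 2 s<m))) (<-irrefl refl)
  ... | tri> _ _ m<s = contradiction
    (≤-trans (subst₂ _≤_ (+-suc (2 ^ m) j) (cong (2 ^ m +_) (sym (+-identityʳ (2 ^ m)))) (+-monoʳ-≤ (2 ^ m) j<2^m))
      (≤-trans (^-monoʳ-≤ 2 m<s) (subst (2 ^ length s ≤_) eq (encStr-lower s)))) (<-irrefl refl)

nthStr-surjective : ∀ m s → length s ≡ m → Σ ℕ λ j → j < 2 ^ m × nthStr m j ≡ s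
nthStr-surjective .(length s) s refl = j , j<2^m , trans (cong (λ z → decStr (pred z)) 2^m+j≡) (decStr-encStr s)
  where
  j = suc (encStr s) ∸ 2 ^ length s
  2^m+j≡ : 2 ^ length s + j ≡ suc (encStr s)
  2^m+j≡ = m+[n∸m]≡n (encStr-lower s)
  j<2^m : j < 2 ^ length s
  j<2^m = +-cancelˡ-< (2 ^ length s) j (2 ^ length s)
    (subst₂ _<_ (sym 2^m+j≡) (cong (2 ^ length s +_) (+-identityʳ (2 ^ length s))) (encStr-upper s))

overwrite : Str → Str → Str
overwrite s t = s ++ drop (length s) t

module Coding (A : ℕ → Bool) where
  open Computability A public

  triangleR : Rep₁ triangle
  triangleR = fun₁ (recR (const 0) (app₂ +R (sucR x₀) x₁) x₀)

  opaque
    unfolding pair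

    pairR : Rep₂ pair
    pairR = fun₂ (app₂ +R x₀ (app₁ triangleR (app₂ +R x₀ x₁)))

  diagonalR : Rep₁ diagonal
  diagonalR = fun₁ (recR (const 0)
    (app₂ +R x₁ (app₂ ∸R (const 1) (app₂ ∸R (app₁ triangleR (sucR x₁)) (sucR x₀)))) x₀)

  fstR : Rep₁ fst
  fstR = Rep₁-≗ (fun₁ (app₂ ∸R x₀ (app₁ triangleR (app₁ diagonalR x₀)))) fst-formula

  sndR : Rep₁ snd
  sndR = Rep₁-≗ (fun₁ (app₂ ∸R (app₁ diagonalR x₀) (app₁ fstR x₀))) snd-formula

  digitR : Rep₁ digit
  digitR = fun₁ (recR (const 0) (sucR (app₂ *R x₁ (app₂ ∸R (const 2) x₁))) x₀)

  halveR : Rep₁ halve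
  halveR = fun₁ (recR (const 0) (app₂ +R x₁ (app₂ ∸R (app₁ digitR x₀) (const 1))) x₀)

  dropCodeR : Rep₂ dropCode
  dropCodeR = Rep₂-≗ (fun₂ (recR x₁ (app₁ halveR x₁) x₀)) dropCode-rec

  bitAtR : Rep₂ (λ a i → bitCode (bitAt (decStr a) i))
  bitAtR = Rep₂-≗ (fun₂ (app₁ digitR (app₂ dropCodeR x₁ x₀))) (λ a i → digit-drop i (decStr a))

  lengthR : Rep₁ lengthCode
  lengthR = fun₁ (muR {v = λ ρ → lengthCode (lookup ρ zero)} (app₂ dropCodeR x₀ x₁)
    (λ { (a ∷ []) → encStr-drop≡0 {decStr a} })
    (λ { (a ∷ []) z z<l → encStr-drop≢0 (decStr a) z z<l }))

  nthCodeR : Rep₂ nthCode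
  nthCodeR = fun₂ (app₁ predR (app₂ +R (app₁ 2^R x₀) x₁))

  overwriteR : Rep₂ (λ a b → encStr (overwrite (decStr a) (decStr b)))
  overwriteR = Rep₂-≗
    (fun₂ (app₂ +R x₀ (app₂ *R (app₁ 2^R (app₁ lengthR x₀)) (app₂ dropCodeR (app₁ lengthR x₀) x₁))))
    (λ a b → sym (trans (encStr-++ (decStr a) _)
      (cong (λ z → z + 2 ^ lengthCode a * dropCode (lengthCode a) b) (encStr-decStr a))))

-- Codes of formulas

toFin-toℕ : ∀ {k} (i : Fin k) → toFin k (toℕ i) ≡ just i
toFin-toℕ zero    = refl
toFin-toℕ (suc i) = cong (Maybe.map suc) (toFin-toℕ i)

encTerm : ∀ {k} → Term k → ℕ
encTerm (var i)  = suc (pair 0 (toℕ i))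
encTerm tzero    = 0
encTerm (tsuc t) = suc (pair 2 (encTerm t))
encTerm (t ⊹ s)  = suc (pair 3 (pair (encTerm t) (encTerm s)))
encTerm (t ⊛ s)  = suc (pair 4 (pair (encTerm t) (encTerm s)))

encForm : ∀ {k} → Formula k → ℕ
encForm (t ≐ s) = suc (pair 0 (pair (encTerm t) (encTerm s)))
encForm (t ≺ s) = suc (pair 1 (pair (encTerm t) (encTerm s)))
encForm (t ∈G)  = suc (pair 2 (encTerm t))
encForm (t ∉G)  = suc (pair 3 (encTerm t))
encForm (φ ∧̇ ψ) = suc (pair 4 (pair (encForm φ) (encForm ψ)))
encForm (¬̇ φ)   = suc (pair 5 (encForm φ))
encForm (∃̇ φ)   = suc (pair 6 (encForm φ))

-- The decoders use the code itself as fuel. Components of a pair are at most the pair, and each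
-- constructor adds 1, so the fuel never runs out.
fuel : ∀ c {f r} → suc (pair c r) ≤ suc f → r ≤ f
fuel c {r = r} (s≤s p≤f) = ≤-trans (b≤pair c r) p≤f

fuelˡ : ∀ c a b {f} → suc (pair c (pair a b)) ≤ suc f → a ≤ f
fuelˡ c a b p≤f = ≤-trans (a≤pair a b) (fuel c p≤f)

fuelʳ : ∀ c a b {f} → suc (pair c (pair a b)) ≤ suc f → b ≤ f
fuelʳ c a b p≤f = ≤-trans (b≤pair a b) (fuel c p≤f)

decTermF-encTerm : ∀ {k} (t : Term k) f → encTerm t ≤ f → decTermF f (encTerm t) ≡ t
decTermF-encTerm (var i) (suc f) _
  rewrite unpair-pair 0 (toℕ i) | toFin-toℕ i = refl
decTermF-encTerm tzero zero    _ = refl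
decTermF-encTerm tzero (suc f) _ = refl
decTermF-encTerm (tsuc t) (suc f) t≤f
  rewrite unpair-pair 2 (encTerm t) = cong tsuc (decTermF-encTerm t f (fuel 2 t≤f))
decTermF-encTerm (t ⊹ s) (suc f) t≤f
  rewrite unpair-pair 3 (pair (encTerm t) (encTerm s)) | unpair-pair (encTerm t) (encTerm s) =
  cong₂ _⊹_ (decTermF-encTerm t f (fuelˡ 3 (encTerm t) (encTerm s) t≤f))
            (decTermF-encTerm s f (fuelʳ 3 (encTerm t) (encTerm s) t≤f))
decTermF-encTerm (t ⊛ s) (suc f) t≤f
  rewrite unpair-pair 4 (pair (encTerm t) (encTerm s)) | unpair-pair (encTerm t) (encTerm s) =
  cong₂ _⊛_ (decTermF-encTerm t f (fuelˡ 4 (encTerm t) (encTerm s) t≤f))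
            (decTermF-encTerm s f (fuelʳ 4 (encTerm t) (encTerm s) t≤f))

decTerm-encTerm : ∀ {k} (t : Term k) → decTerm (encTerm t) ≡ t
decTerm-encTerm t = decTermF-encTerm t (encTerm t) ≤-refl

decFormF-encForm : ∀ {k} (φ : Formula k) f → encForm φ ≤ f → decFormF f (encForm φ) ≡ φ
decFormF-encForm (t ≐ s) (suc f) _
  rewrite unpair-pair 0 (pair (encTerm t) (encTerm s)) | unpair-pair (encTerm t) (encTerm s) =
  cong₂ _≐_ (decTerm-encTerm t) (decTerm-encTerm s)
decFormF-encForm (t ≺ s) (suc f) _
  rewrite unpair-pair 1 (pair (encTerm t) (encTerm s)) | unpair-pair (encTerm t) (encTerm s) =
  cong₂ _≺_ (decTerm-encTerm t) (decTerm-encTerm s)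
decFormF-encForm (t ∈G) (suc f) _
  rewrite unpair-pair 2 (encTerm t) = cong _∈G (decTerm-encTerm t)
decFormF-encForm (t ∉G) (suc f) _
  rewrite unpair-pair 3 (encTerm t) = cong _∉G (decTerm-encTerm t)
decFormF-encForm (φ ∧̇ ψ) (suc f) φ≤f
  rewrite unpair-pair 4 (pair (encForm φ) (encForm ψ)) | unpair-pair (encForm φ) (encForm ψ) =
  cong₂ _∧̇_ (decFormF-encForm φ f (fuelˡ 4 (encForm φ) (encForm ψ) φ≤f))
            (decFormF-encForm ψ f (fuelʳ 4 (encForm φ) (encForm ψ) φ≤f))
decFormF-encForm (¬̇ φ) (suc f) φ≤f
  rewrite unpair-pair 5 (encForm φ) = cong ¬̇_ (decFormF-encForm φ f (fuel 5 φ≤f))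
decFormF-encForm (∃̇ φ) (suc f) φ≤f
  rewrite unpair-pair 6 (encForm φ) = cong ∃̇_ (decFormF-encForm φ f (fuel 6 φ≤f))

sentence-encForm : (φ : Formula 0) → sentence (encForm φ) ≡ φ
sentence-encForm φ = decFormF-encForm φ (encForm φ) ≤-refl

numeral : ∀ {k} → ℕ → Term k
numeral zero    = tzero
numeral (suc n) = tsuc (numeral n)

⟦numeral⟧ : ∀ {k} n {ρ : Vec ℕ k} → ⟦ numeral n ⟧ ρ ≡ n
⟦numeral⟧ zero    = refl
⟦numeral⟧ (suc n) = cong suc (⟦numeral⟧ n)

numeralCode : ℕ → ℕ
numeralCode = natrec 0 (λ _ c → suc (pair 2 c))

encTerm-numeral : ∀ {k} n → encTerm (numeral {k} n) ≡ numeralCode n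
encTerm-numeral zero = refl
encTerm-numeral {k} (suc n) = cong (λ c → suc (pair 2 c)) (encTerm-numeral {k} n)

-- The numerals are not substituted into `ψ`; its variables are pinned by equations instead. The
-- code of `ψ` then enters the code of the sentence unchanged, and no substitution on codes has to
-- be computed.
instantiate : BFormula 3 → ℕ → ℕ → BFormula 3
instantiate ψ d m = andᶠ (eqᶠ v₂ (numeral d)) (andᶠ (eqᶠ v₁ (numeral m)) ψ)

-- the code of ∃ d' m' w. d' = d ∧ m' = m ∧ ψ, where d codes ψ
diagCode : ℕ → ℕ → ℕ
diagCode d m = suc (pair 6 (suc (pair 6 (suc (pair 6
  (suc (pair 4 (pair (suc (pair 0 (pair (suc (pair 0 2)) (numeralCode d))))
    (suc (pair 4 (pair (suc (pair 0 (pair (suc (pair 0 1)) (numeralCode m)))) d)))))))))))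

-- The self-reference: with the code of `ψ` itself as d, the number `diagCode d m` codes the very
-- sentence that applies `ψ` to d and m.
sentence-diagCode : ∀ (ψ : BFormula 3) m →
  sentence (diagCode (encForm ⌊ ψ ⌋) m) ≡ (∃̇ ∃̇ ∃̇ ⌊ instantiate ψ (encForm ⌊ ψ ⌋) m ⌋)
sentence-diagCode ψ m = trans (cong sentence (sym code≡)) (sentence-encForm φ)
  where
  d = encForm ⌊ ψ ⌋
  φ : Formula 0
  φ = ∃̇ ∃̇ ∃̇ ⌊ instantiate ψ d m ⌋
  code≡ : encForm φ ≡ diagCode d m
  code≡ = cong₂ (λ c c′ → suc (pair 6 (suc (pair 6 (suc (pair 6
    (suc (pair 4 (pair (suc (pair 0 (pair (suc (pair 0 2)) c)))
      (suc (pair 4 (pair (suc (pair 0 (pair (suc (pair 0 1)) c′))) d)))))))))))) (encTerm-numeral {3} d) (encTerm-numeral {3} m)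

module DiagonalCoding (A : ℕ → Bool) where
  open Coding A public

  numeralCodeR : Rep₁ numeralCode
  numeralCodeR = fun₁ (recR (const 0) (sucR (app₂ pairR (const 2) x₁)) x₀)

  diagCodeR : Rep₂ diagCode
  diagCodeR = fun₂ (tag 6 (tag 6 (tag 6
    (tag 4 (app₂ pairR (tag 0 (app₂ pairR (const (suc (pair 0 2))) (app₁ numeralCodeR x₀)))
      (tag 4 (app₂ pairR (tag 0 (app₂ pairR (const (suc (pair 0 1))) (app₁ numeralCodeR x₁))) x₀)))))))
    where
    tag : ∀ {k} {e : Vec ℕ k → ℕ} c → Rep e → Rep (λ ρ → suc (pair c (e ρ)))
    tag c e = sucR (app₂ pairR (const c) e)

-- The product forcing

isPrefixᵇ⇒≼ : ∀ s t → isPrefixᵇ s t ≡ true → s ≼ t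
isPrefixᵇ⇒≼ []          t           _  = t , refl
isPrefixᵇ⇒≼ (true ∷ s)  (true ∷ t)  eq with isPrefixᵇ⇒≼ s t eq
... | u , refl = u , refl
isPrefixᵇ⇒≼ (false ∷ s) (false ∷ t) eq with isPrefixᵇ⇒≼ s t eq
... | u , refl = u , refl

++-isPrefixᵇ : ∀ s t → isPrefixᵇ s (s ++ t) ≡ true
++-isPrefixᵇ []          t = refl
++-isPrefixᵇ (true ∷ s)  t = ++-isPrefixᵇ s t
++-isPrefixᵇ (false ∷ s) t = ++-isPrefixᵇ s t

≼⇒isPrefixᵇ : ∀ {s t} → s ≼ t → isPrefixᵇ s t ≡ true
≼⇒isPrefixᵇ {s} (u , refl) = ++-isPrefixᵇ s u

≼-refl : ∀ {s} → s ≼ s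
≼-refl {[]}    = [] , refl
≼-refl {b ∷ s} with ≼-refl {s}
... | u , eq = u , cong (b ∷_) eq

≼-trans : ∀ {s t u} → s ≼ t → t ≼ u → s ≼ u
≼-trans {s} (v , refl) (w , refl) = v ++ w , sym (++-assoc s v w)

≼⇒⊑ : ∀ {s t} → s ≼ t → s ⊑ t
≼⇒⊑ {b ∷ s} (u , refl) zero    c eq = eq
≼⇒⊑ {b ∷ s} (u , refl) (suc n) c eq = ≼⇒⊑ {s} (u , refl) n c eq

==ᵇ⇒≡ : ∀ m n → (m ==ᵇ n) ≡ true → m ≡ n
==ᵇ⇒≡ zero    zero    _  = refl
==ᵇ⇒≡ (suc m) (suc n) eq = cong suc (==ᵇ⇒≡ m n eq)

==ᵇ-refl : ∀ n → (n ==ᵇ n) ≡ true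
==ᵇ-refl zero    = refl
==ᵇ-refl (suc n) = ==ᵇ-refl n

interleave-++ : ∀ s t u v → length s ≡ length t →
                interleave (s ++ u) (t ++ v) ≡ interleave s t ++ interleave u v
interleave-++ []      []      u v _  = refl
interleave-++ (a ∷ s) (b ∷ t) u v eq = cong (λ w → a ∷ b ∷ w) (interleave-++ s t u v (suc-injective eq))

interleave-length : ∀ s t → length s ≡ length t → length t ≤ length (interleave s t)
interleave-length []      []      _  = z≤n
interleave-length (a ∷ s) (b ∷ t) eq = s≤s (m≤n⇒m≤1+n (interleave-length s t (suc-injective eq)))

⊏-tail : ∀ {b s X} → (b ∷ s) ⊏ X → s ⊏ (λ n → X (suc n))
⊏-tail bs⊏X n = bs⊏X (suc n)

interleave-⊏ : ∀ s t {S G} → s ⊏ S → t ⊏ G → interleave s t ⊏ (S ⊕ G)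
interleave-⊏ (a ∷ s) (b ∷ t) s⊏S t⊏G zero          c refl = s⊏S 0 a refl
interleave-⊏ (a ∷ s) (b ∷ t) s⊏S t⊏G (suc zero)    c refl = t⊏G 0 b refl
interleave-⊏ (a ∷ s) (b ∷ t) s⊏S t⊏G (suc (suc n)) c eq   =
  interleave-⊏ s t (⊏-tail s⊏S) (⊏-tail t⊏G) n c eq

module Product (ℙ : Forcing) where
  open Forcing ℙ
  D : ForcingData
  D = product ℙ
  open ForcingData D public using () renaming (P to P×; le to le×; V to V×)

  str : ℕ → Str
  str n = decStr (fst n)

  P×-def : ∀ n → P× n ≡ P (snd n) ∧ (length (str n) ==ᵇ length (V (snd n)))
  P×-def n with unpair n
  ... | a , b = refl

  le×-def : ∀ n m → le× n m ≡ isPrefixᵇ (str m) (str n) ∧ le (snd n) (snd m)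
  le×-def n m with unpair n | unpair m
  ... | a , b | c , d = refl

  V×-def : ∀ n → V× n ≡ interleave (str n) (V (snd n))
  V×-def n with unpair n
  ... | a , b = refl

  P×⇒P : ∀ {n} → P× n ≡ true → P (snd n) ≡ true
  P×⇒P {n} eq = Bool.∧-conicalˡ _ _ (trans (sym (P×-def n)) eq)

  P×⇒length : ∀ {n} → P× n ≡ true → length (str n) ≡ length (V (snd n))
  P×⇒length {n} eq = ==ᵇ⇒≡ _ _ (Bool.∧-conicalʳ (P (snd n)) _ (trans (sym (P×-def n)) eq))

  le×⇒≼ : ∀ {n m} → le× n m ≡ true → str m ≼ str n
  le×⇒≼ {n} {m} eq = isPrefixᵇ⇒≼ (str m) (str n) (Bool.∧-conicalˡ _ _ (trans (sym (le×-def n m)) eq))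

  le×⇒le : ∀ {n m} → le× n m ≡ true → le (snd n) (snd m) ≡ true
  le×⇒le {n} {m} eq = Bool.∧-conicalʳ (isPrefixᵇ (str m) (str n)) _ (trans (sym (le×-def n m)) eq)

  le×-intro : ∀ {n m} → str m ≼ str n → le (snd n) (snd m) ≡ true → le× n m ≡ true
  le×-intro {n} {m} m≼n n≤m = trans (le×-def n m) (cong₂ _∧_ (≼⇒isPrefixᵇ m≼n) n≤m)

  cond : Str → ℕ → ℕ
  cond σ p = pair (encStr σ) p

  str-cond : ∀ σ p → str (cond σ p) ≡ σ
  str-cond σ p = trans (cong decStr (fst-pair (encStr σ) p)) (decStr-encStr σ)

  snd-cond : ∀ σ p → snd (cond σ p) ≡ p
  snd-cond σ p = snd-pair (encStr σ) p

  cond-P× : ∀ σ p → P p ≡ true → length σ ≡ length (V p) → P× (cond σ p) ≡ true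
  cond-P× σ p Pp σ≡Vp = begin
    P× (cond σ p)
      ≡⟨ P×-def (cond σ p) ⟩
    P (snd (cond σ p)) ∧ (length (str (cond σ p)) ==ᵇ length (V (snd (cond σ p))))
      ≡⟨ cong₂ (λ q τ → P q ∧ (length τ ==ᵇ length (V q))) (snd-cond σ p) (str-cond σ p) ⟩
    P p ∧ (length σ ==ᵇ length (V p))
      ≡⟨ cong₂ _∧_ Pp (trans (cong (_==ᵇ length (V p)) σ≡Vp) (==ᵇ-refl (length (V p)))) ⟩
    true ∎
    where open ≡-Reasoning

  cond-le× : ∀ σ p m → str m ≼ σ → le p (snd m) ≡ true → le× (cond σ p) m ≡ true
  cond-le× σ p m m≼σ p≤m =
    le×-intro {cond σ p} {m} (subst (str m ≼_) (sym (str-cond σ p)) m≼σ)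
      (subst (λ q → le q (snd m) ≡ true) (sym (snd-cond σ p)) p≤m)

  le×-refl : ∀ n → P× n ≡ true → le× n n ≡ true
  le×-refl n Pn = le×-intro {n} {n} ≼-refl (le-refl (snd n) (P×⇒P {n} Pn))

  le×-trans : ∀ n m k → P× n ≡ true → P× m ≡ true → P× k ≡ true →
              le× n m ≡ true → le× m k ≡ true → le× n k ≡ true
  le×-trans n m k Pn Pm Pk n≤m m≤k = le×-intro {n} {k} (≼-trans (le×⇒≼ {m} {k} m≤k) (le×⇒≼ {n} {m} n≤m))
    (le-trans _ _ _ (P×⇒P {n} Pn) (P×⇒P {m} Pm) (P×⇒P {k} Pk) (le×⇒le {n} {m} n≤m) (le×⇒le {m} {k} m≤k))

  V×-⊑ : ∀ n m → P× n ≡ true → P× m ≡ true → le× m n ≡ true → V× n ⊑ V× m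
  V×-⊑ n m Pn Pm m≤n rewrite V×-def n | V×-def m
    with le×⇒≼ {m} {n} m≤n | V-mono (snd n) (snd m) (P×⇒P {n} Pn) (P×⇒P {m} Pm) (le×⇒le {m} {n} m≤n)
  ... | u , eq | v , eq′ =
    ≼⇒⊑ (interleave u v , trans (sym (interleave-++ (str n) (V (snd n)) u v (P×⇒length {n} Pn))) (cong₂ interleave eq eq′))

  V×-⊏ : ∀ n {S G} → str n ⊏ S → V (snd n) ⊏ G → V× n ⊏ (S ⊕ G)
  V×-⊏ n n⊏S n⊏G rewrite V×-def n = interleave-⊏ (str n) (V (snd n)) n⊏S n⊏G

  V×-length : ∀ n → P× n ≡ true → length (V (snd n)) ≤ length (V× n)
  V×-length n Pn rewrite V×-def n = interleave-length (str n) (V (snd n)) (P×⇒length {n} Pn)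

  product-isMonotoneOrder : IsMonotoneOrder D
  product-isMonotoneOrder = record { reflexive = le×-refl ; transitive = le×-trans ; monotone = V×-⊑ }

  open Forcing-Δ₀ D product-isMonotoneOrder public

  -- Only finitely many conditions are numbers below s, so a long enough valuation forces the number past s.
  extension : ∀ n N s → P× n ≡ true →
              Σ ℕ λ m → P× m ≡ true × le× m n ≡ true × N ≤ length (str m) × s ≤ snd m
  extension n N s Pn with bounded-values (λ p → length (V p)) s
  ... | M , V≤M with V-dense (N + suc M) (snd n) (P×⇒P {n} Pn)
  ...   | q , Pq , q≤n , V≥ =
    cond σ q ,
    cond-P× σ q Pq σ≡Vq ,
    cond-le× σ q n (replicate _ false , refl) q≤n ,
    subst (N ≤_) (sym (trans (cong length (str-cond σ q)) σ≡Vq)) (m+n≤o⇒m≤o N V≥) ,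
    subst (s ≤_) (sym (snd-cond σ q))
      (≮⇒≥ (λ q<s → <-irrefl refl (≤-trans (m+n≤o⇒n≤o N V≥) (V≤M q q<s))))
    where
    σ : Str
    σ = str n ++ replicate (length (V q) ∸ length (str n)) false
    n≤q : length (str n) ≤ length (V q)
    n≤q = subst (_≤ length (V q)) (sym (P×⇒length {n} Pn))
      (⊑-length (V (snd n)) (V q) (≼⇒⊑ (V-mono (snd n) q (P×⇒P {n} Pn) Pq q≤n)))
    σ≡Vq : length σ ≡ length (V q)
    σ≡Vq = trans (length-++ (str n)) (trans (cong (length (str n) +_) (length-replicate _)) (m+[n∸m]≡n n≤q))

-- The construction

least : (t : ℕ → ℕ) → Σ ℕ (λ y → t y ≡ 0) → Σ ℕ λ m → t m ≡ 0 × (∀ z → z < m → ¬ t z ≡ 0)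
least t (y , ty≡0) = result (below (suc y))
  where
  Least : Set
  Least = Σ ℕ λ m → t m ≡ 0 × (∀ z → z < m → ¬ t z ≡ 0)
  below : ∀ n → Least ⊎ (∀ z → z < n → ¬ t z ≡ 0)
  below zero = inj₂ λ _ ()
  below (suc n) with below n | t n ≟ 0
  ... | inj₁ l | _        = inj₁ l
  ... | inj₂ f | yes tn≡0 = inj₁ (n , tn≡0 , f)
  ... | inj₂ f | no tn≢0  = inj₂ λ z z<1+n → case z (m<1+n⇒m<n∨m≡n z<1+n)
    where
    case : ∀ z → z < n ⊎ z ≡ n → ¬ t z ≡ 0
    case z (inj₁ z<n)  = f z z<n
    case z (inj₂ refl) = tn≢0
  result : Least ⊎ (∀ z → z < suc y → ¬ t z ≡ 0) → Least
  result (inj₁ l) = l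
  result (inj₂ f) = contradiction ty≡0 (f y ≤-refl)

1∸b2n≡0⇒ : ∀ b → 1 ∸ b2n b ≡ 0 → b ≡ true
1∸b2n≡0⇒ true _ = refl

⇒1∸b2n≡0 : ∀ {b} → b ≡ true → 1 ∸ b2n b ≡ 0
⇒1∸b2n≡0 refl = refl

if-arithmetic : ∀ b x y → b2n b * x + (1 ∸ b2n b) * y ≡ (if b then x else y)
if-arithmetic true  x y = trans (+-identityʳ (x + 0)) (+-identityʳ x)
if-arithmetic false x y = +-identityʳ y

bitAt-++ˡ : ∀ s t i → i < length s → bitAt (s ++ t) i ≡ bitAt s i
bitAt-++ˡ (b ∷ s) t zero    _         = refl
bitAt-++ˡ (b ∷ s) t (suc i) (s≤s i<s) = bitAt-++ˡ s t i i<s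

bitAt-∷ʳ : ∀ s b → bitAt (s ++ b ∷ []) (length s) ≡ just b
bitAt-∷ʳ []      b = refl
bitAt-∷ʳ (_ ∷ s) b = bitAt-∷ʳ s b

bitAt-initSeg : ∀ S n i → i < n → bitAt (initSeg S n) i ≡ just (S i)
bitAt-initSeg S (suc n) zero    _         = refl
bitAt-initSeg S (suc n) (suc i) (s≤s i<n) = bitAt-initSeg (λ m → S (suc m)) n i i<n

length-initSeg : ∀ S n → length (initSeg S n) ≡ n
length-initSeg S zero    = refl
length-initSeg S (suc n) = cong suc (length-initSeg (λ m → S (suc m)) n)

initSeg-⊏ : ∀ S n → initSeg S n ⊏ S
initSeg-⊏ S (suc n) zero    b refl = refl
initSeg-⊏ S (suc n) (suc i) b eq   = initSeg-⊏ (λ m → S (suc m)) n i b eq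

⊏⇒≼-initSeg : ∀ s S n → s ⊏ S → length s ≤ n → s ≼ initSeg S n
⊏⇒≼-initSeg []      S n       _   _         = initSeg S n , refl
⊏⇒≼-initSeg (b ∷ s) S (suc n) s⊏S (s≤s s≤n)
  with ⊏⇒≼-initSeg s (λ m → S (suc m)) n (⊏-tail s⊏S) s≤n
... | u , eq = u , cong₂ _∷_ (sym (s⊏S 0 b refl)) eq

bitAt-overwrite-< : ∀ s t i → i < length s → bitAt (overwrite s t) i ≡ bitAt s i
bitAt-overwrite-< s t = bitAt-++ˡ s (drop (length s) t)

bitAt-overwrite-≥ : ∀ s t i → length s ≤ i → bitAt (overwrite s t) i ≡ bitAt t i
bitAt-overwrite-≥ []      t       i       _         = refl
bitAt-overwrite-≥ (b ∷ s) (c ∷ t) (suc i) (s≤s s≤i) = bitAt-overwrite-≥ s t i s≤i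
bitAt-overwrite-≥ (b ∷ s) []      (suc i) (s≤s s≤i) =
  trans (cong (λ u → bitAt (s ++ u) i) (sym (drop-[] (length s)))) (bitAt-overwrite-≥ s [] i s≤i)

length-overwrite : ∀ s t → length s ≤ length t → length (overwrite s t) ≡ length t
length-overwrite s t s≤t =
  trans (length-++ s) (trans (cong (length s +_) (length-drop (length s) t)) (m+[n∸m]≡n s≤t))

module Construction (A : ℕ → Bool) (ℙ : Forcing) (decidable : OneDecidable (product ℙ) A) where
  open Forcing ℙ
  open Product ℙ
  open DiagonalCoding A

  P×R : Rep₁ (λ n → b2n (P× n))
  P×R = proj₁ (proj₁ decidable)

  default : ℕ
  default = cond (replicate (length (V p)) false) p
    where p = proj₁ (P-infinite 0)

  default-P× : P× default ≡ true
  default-P× = cond-P× (replicate (length (V p)) false) p (proj₂ (proj₂ (P-infinite 0))) (length-replicate (length (V p)))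
    where p = proj₁ (P-infinite 0)

  -- The given programs need only halt on conditions, so their inputs are first normalized to conditions.
  norm : ℕ → ℕ
  norm n = if P× n then n else default

  norm-P× : ∀ n → P× (norm n) ≡ true
  norm-P× n with P× n in eq
  ... | true  = eq
  ... | false = default-P×

  norm-id : ∀ {n} → P× n ≡ true → norm n ≡ n
  norm-id {n} eq rewrite eq = refl

  normR : Rep₁ norm
  normR = Rep₁-≗ (fun₁ (app₂ +R (app₂ *R (app₁ P×R x₀) x₀)
                               (app₂ *R (app₂ ∸R (const 1) (app₁ P×R x₀)) (const default))))
                 (λ n → if-arithmetic (P× n) n default)

  le×R : Rep₂ (λ m n → b2n (le× (norm m) (norm n)))
  le×R = let c , c-computes = proj₁ (proj₂ (proj₁ decidable)) ; d , d-computes = normR in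
    comp c (comp d (proj zero ∷ []) ∷ comp d (proj (suc zero) ∷ []) ∷ []) , λ m n →
      ev-comp (ev-comp (ev-proj ∷ []) (d-computes m) ∷ ev-comp (ev-proj ∷ []) (d-computes n) ∷ [])
              (c-computes (norm m) (norm n) (norm-P× m) (norm-P× n))

  -- For a condition `n`, this vanishes just when `m` is a condition below `n` with Cohen part
  -- longer than `L` and ℙ-part at least `s` as a number.
  searchTest : ℕ → ℕ → ℕ → ℕ → ℕ
  searchTest m n L s = (1 ∸ b2n (P× m)) + ((1 ∸ b2n (le× (norm m) (norm n))) +
                       ((suc L ∸ lengthCode (fst m)) + (s ∸ snd m)))

  searchTestR : Rep₄ searchTest
  searchTestR = fun₄ (app₂ +R (app₂ ∸R (const 1) (app₁ P×R x₀)) (app₂ +R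
    (app₂ ∸R (const 1) (app₂ le×R x₀ x₁))
    (app₂ +R (app₂ ∸R (sucR x₂) (app₁ lengthR (app₁ fstR x₀))) (app₂ ∸R x₃ (app₁ sndR x₀)))))

  searchTest-satisfiable : ∀ n L s → Σ ℕ λ m → searchTest m n L s ≡ 0
  searchTest-satisfiable n L s with extension (norm n) (suc L) s (norm-P× n)
  ... | m , Pm , m≤n , L<m , s≤m = m , cong₂ _+_ (⇒1∸b2n≡0 Pm) (cong₂ _+_
    (⇒1∸b2n≡0 (subst (λ m → le× m (norm n) ≡ true) (sym (norm-id {m} Pm)) m≤n))
    (cong₂ _+_ (m≤n⇒m∸n≡0 L<m) (m≤n⇒m∸n≡0 s≤m)))

  opaque
    search : ℕ → ℕ → ℕ → ℕ
    search n L s = proj₁ (least (λ m → searchTest m n L s) (searchTest-satisfiable n L s))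

    search-test : ∀ n L s → searchTest (search n L s) n L s ≡ 0
    search-test n L s = proj₁ (proj₂ (least (λ m → searchTest m n L s) (searchTest-satisfiable n L s)))

    search-least : ∀ n L s m → m < search n L s → ¬ searchTest m n L s ≡ 0
    search-least n L s = proj₂ (proj₂ (least (λ m → searchTest m n L s) (searchTest-satisfiable n L s)))

  searchR : Rep₃ search
  searchR = fun₃ (muR {v = λ ρ → search (lookup ρ zero) (lookup ρ (suc zero)) (lookup ρ (suc (suc zero)))}
    (app₄ searchTestR x₀ x₁ x₂ x₃)
    (λ { (n ∷ L ∷ s ∷ []) → search-test n L s })
    (λ { (n ∷ L ∷ s ∷ []) → search-least n L s }))

  search-P× : ∀ n L s → P× (search n L s) ≡ true
  search-P× n L s = 1∸b2n≡0⇒ _ (m+n≡0⇒m≡0 _ (search-test n L s))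

  search-le× : ∀ n L s → P× n ≡ true → le× (search n L s) n ≡ true
  search-le× n L s Pn = subst₂ (λ m n → le× m n ≡ true) (norm-id {search n L s} (search-P× n L s)) (norm-id {n} Pn)
    (1∸b2n≡0⇒ _ (m+n≡0⇒m≡0 _ (m+n≡0⇒n≡0 (1 ∸ b2n (P× (search n L s))) (search-test n L s))))

  search-length : ∀ n L s → L < length (str (search n L s))
  search-length n L s = m∸n≡0⇒m≤n (m+n≡0⇒m≡0 _ (m+n≡0⇒n≡0 (1 ∸ b2n (le× (norm (search n L s)) (norm n)))
    (m+n≡0⇒n≡0 (1 ∸ b2n (P× (search n L s))) (search-test n L s))))

  search-≥ : ∀ n L s → s ≤ snd (search n L s)
  search-≥ n L s = m∸n≡0⇒m≤n (m+n≡0⇒n≡0 (suc L ∸ lengthCode (fst (search n L s)))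
    (m+n≡0⇒n≡0 (1 ∸ b2n (le× (norm (search n L s)) (norm n)))
      (m+n≡0⇒n≡0 (1 ∸ b2n (P× (search n L s))) (search-test n L s))))

  f₁ f₂ : PR 2
  f₁ = proj₁ (proj₂ decidable)
  f₂ = proj₁ (proj₂ (proj₂ decidable))

  -- The answer t is kept as an evaluation of `f₂` with oracle A, the form in which it is later
  -- transferred to the oracle S ⊕ G.
  Decides : ℕ → ℕ → ℕ → Set
  Decides n i m = P× m ≡ true × le× m n ≡ true × Σ ℕ λ t → Eval A f₂ (n ∷ i ∷ []) t × (t ≡ 1 ⊎ t ≡ 0) ×
    (Σ₁ (sentence i) → (t ≡ 1 → Forces D m (sentence i) []) × (t ≡ 0 → Forces D m (¬̇ sentence i) []))

  ask : ℕ → ℕ → ℕ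
  ask n i = proj₁ (proj₂ (proj₂ (proj₂ decidable)) (norm n) i (norm-P× n))

  askR : Rep₂ ask
  askR = let d , d-computes = normR in
    comp f₁ (comp d (proj zero ∷ []) ∷ proj (suc zero) ∷ []) , λ n i →
      ev-comp (ev-comp (ev-proj ∷ []) (d-computes n) ∷ ev-proj ∷ [])
              (proj₁ (proj₂ (proj₂ (proj₂ (proj₂ (proj₂ decidable)) (norm n) i (norm-P× n)))))

  ask-decides : ∀ n i → P× n ≡ true → Decides n i (ask n i)
  ask-decides n i Pn = subst (λ m → Decides m i (ask n i)) (norm-id {n} Pn)
    (let _ , t , _ , ev₂ , Pm , m≤n , t∈2 , forces = proj₂ (proj₂ (proj₂ decidable)) (norm n) i (norm-P× n)
     in Pm , m≤n , t , ev₂ , t∈2 , forces)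

  redirectStr : ℕ → ℕ → ℕ → Str
  redirectStr L j n = overwrite (nthStr (suc L) j) (str n)

  redirect : ℕ → ℕ → ℕ → ℕ
  redirect L j n = cond (redirectStr L j n) (snd n)

  redirectR : Rep₃ redirect
  redirectR = fun₃ (app₂ pairR (app₂ overwriteR (app₂ nthCodeR (sucR x₀) x₁) (app₁ fstR x₂)) (app₁ sndR x₂))

  step : ℕ → ℕ → ℕ → ℕ → ℕ
  step d L j n = ask (redirect L j n) (diagCode d (redirect L j n))

  stepR : Rep₄ step
  stepR = fun₄ (app₂ askR (app₃ redirectR x₁ x₂ x₃) (app₂ diagCodeR x₀ (app₃ redirectR x₁ x₂ x₃)))

  loop : ℕ → ℕ → ℕ → ℕ → ℕ
  loop d L n = natrec n (step d L)

  loopR : Rep₄ loop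
  loopR = fun₄ (recR x₂ (app₄ stepR x₂ x₃ x₀ x₁) x₃)

  start : ℕ → ℕ → ℕ
  start s L = search (norm (snd s)) L s

  -- The closing search is needed because the conditions returned by `f₁` may have small numbers; it
  -- lifts the ℙ-part to at least the stage number.
  stage : ℕ → ℕ → ℕ
  stage s L = search (loop (fst s) L (start s L) (2 ^ suc L)) L s

  stageR : Rep₂ stage
  stageR = fun₂ (app₃ searchR
    (app₄ loopR (app₁ fstR x₀) x₁ (app₃ searchR (app₁ normR (app₁ sndR x₀)) x₁ x₀) (app₁ 2^R (sucR x₁))) x₁ x₀)

  opaque
    level : ℕ → ℕ
    level = natrec 0 (λ s L → lengthCode (fst (stage s L)))

    level-zero : level 0 ≡ 0
    level-zero = refl

    level-suc : ∀ s → level (suc s) ≡ length (str (stage s (level s)))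
    level-suc s = refl

    levelR : Rep₁ level
    levelR = fun₁ (recR (const 0) (app₁ lengthR (app₁ fstR (app₂ stageR x₀ x₁))) x₀)

  final : ℕ → ℕ
  final s = stage s (level s)

  finalR : Rep₁ final
  finalR = fun₁ (app₂ stageR x₀ (app₁ levelR x₀))

  -- A Cohen part longer than `L` keeps its length when its first L + 1 bits are overwritten, so the
  -- result is again a condition.
  Good : ℕ → ℕ → Set
  Good L n = P× n ≡ true × L < length (str n)

  infix 4 _⊴[_]_

  -- What survives of the product order when the Cohen bits at positions up to L are overwritten. It
  -- holds across the rounds of a stage, where `le×` fails.
  _⊴[_]_ : ℕ → ℕ → ℕ → Set
  m ⊴[ L ] n = le (snd m) (snd n) ≡ true × (∀ i b → L < i → bitAt (str n) i ≡ just b → bitAt (str m) i ≡ just b)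

  ⊴-trans : ∀ {L} k m n → P× k ≡ true → P× m ≡ true → P× n ≡ true → k ⊴[ L ] m → m ⊴[ L ] n → k ⊴[ L ] n
  ⊴-trans k m n Pk Pm Pn (k≤m , k⊒m) (m≤n , m⊒n) =
    le-trans _ _ _ (P×⇒P {k} Pk) (P×⇒P {m} Pm) (P×⇒P {n} Pn) k≤m m≤n ,
    λ i b L<i eq → k⊒m i b L<i (m⊒n i b L<i eq)

  le×⇒⊴ : ∀ {L} m n → le× m n ≡ true → m ⊴[ L ] n
  le×⇒⊴ m n m≤n = le×⇒le {m} {n} m≤n , λ i b _ → ≼⇒⊑ (le×⇒≼ {m} {n} m≤n) i b

  module _ {L j : ℕ} (j< : j < 2 ^ suc L) where
    redirect-length : ∀ n → Good L n → length (redirectStr L j n) ≡ length (str n)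
    redirect-length n (Pn , L<n) = length-overwrite (nthStr (suc L) j) (str n)
      (subst (_≤ length (str n)) (sym (length-nthStr (suc L) j j<)) L<n)

    redirect-Good : ∀ n → Good L n → Good L (redirect L j n)
    redirect-Good n g@(Pn , L<n) =
      cond-P× (redirectStr L j n) (snd n) (P×⇒P {n} Pn) (trans (redirect-length n g) (P×⇒length {n} Pn)) ,
      subst (L <_) (sym (trans (cong length (str-cond (redirectStr L j n) (snd n))) (redirect-length n g))) L<n

    redirect-⊴ : ∀ n → Good L n → redirect L j n ⊴[ L ] n
    redirect-⊴ n (Pn , _) =
      subst (λ p → le p (snd n) ≡ true) (sym (snd-cond (redirectStr L j n) (snd n)))
        (le-refl _ (P×⇒P {n} Pn)) ,
      λ i b L<i eq → trans (cong (λ σ → bitAt σ i) (str-cond (redirectStr L j n) (snd n)))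
        (trans (bitAt-overwrite-≥ (nthStr (suc L) j) (str n) i
                  (subst (_≤ i) (sym (length-nthStr (suc L) j j<)) L<i)) eq)

    redirect-nthStr : ∀ n → nthStr (suc L) j ⊑ str (redirect L j n)
    redirect-nthStr n i b eq = trans (cong (λ σ → bitAt σ i) (str-cond (redirectStr L j n) (snd n)))
      (trans (bitAt-overwrite-< (nthStr (suc L) j) (str n) i (bitAt-just⇒< (nthStr (suc L) j) i eq)) eq)

    step-decides : ∀ d n → Good L n → Decides (redirect L j n) (diagCode d (redirect L j n)) (step d L j n)
    step-decides d n g = ask-decides (redirect L j n) (diagCode d (redirect L j n)) (proj₁ (redirect-Good n g))

    step-Good : ∀ d n → Good L n → Good L (step d L j n)
    step-Good d n g =
      proj₁ (step-decides d n g) ,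
      ≤-trans (proj₂ (redirect-Good n g)) (⊑-length (str (redirect L j n)) (str (step d L j n))
        (≼⇒⊑ (le×⇒≼ {step d L j n} {redirect L j n} (proj₁ (proj₂ (step-decides d n g))))))

    step-⊴ : ∀ d n → Good L n → step d L j n ⊴[ L ] n
    step-⊴ d n g = ⊴-trans (step d L j n) (redirect L j n) n
      (proj₁ (step-decides d n g)) (proj₁ (redirect-Good n g)) (proj₁ g)
      (le×⇒⊴ (step d L j n) (redirect L j n) (proj₁ (proj₂ (step-decides d n g)))) (redirect-⊴ n g)

  loop-Good : ∀ d {L n} → Good L n → ∀ k → k ≤ 2 ^ suc L → Good L (loop d L n k)
  loop-Good d g zero    _  = g
  loop-Good d {L} {n} g (suc k) k< = step-Good k< d (loop d L n k) (loop-Good d g k (<⇒≤ k<))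

  loop-⊴ : ∀ d {L n} → Good L n → ∀ j k → j ≤ k → k ≤ 2 ^ suc L → loop d L n k ⊴[ L ] loop d L n j
  loop-⊴ d {L} {n} g j k j≤k k≤ with m≤n⇒m<n∨m≡n j≤k
  ... | inj₂ refl = le×⇒⊴ (loop d L n j) (loop d L n j) (le×-refl (loop d L n j) (proj₁ (loop-Good d g j k≤)))
  loop-⊴ d {L} {n} g j (suc k) _ k< | inj₁ (s≤s j≤k) =
    ⊴-trans (loop d L n (suc k)) (loop d L n k) (loop d L n j)
      (proj₁ (loop-Good d g (suc k) k<)) (proj₁ (loop-Good d g k (<⇒≤ k<)))
      (proj₁ (loop-Good d g j (≤-trans j≤k (<⇒≤ k<))))
      (step-⊴ k< d (loop d L n k) (loop-Good d g k (<⇒≤ k<))) (loop-⊴ d g j k j≤k (<⇒≤ k<))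

-- The tree and the class of dense sets

module TreeAndClass (A : ℕ → Bool) (ℙ : Forcing) (decidable : OneDecidable (product ℙ) A) where
  open Forcing ℙ
  open Product ℙ
  open DiagonalCoding A
  open Construction A ℙ decidable

  start-Good : ∀ s L → Good L (start s L)
  start-Good s L = search-P× (norm (snd s)) L s , search-length (norm (snd s)) L s

  end : ℕ → ℕ → ℕ
  end s L = loop (fst s) L (start s L) (2 ^ suc L)

  end-Good : ∀ s L → Good L (end s L)
  end-Good s L = loop-Good (fst s) (start-Good s L) (2 ^ suc L) ≤-refl

  stage-P× : ∀ s L → P× (stage s L) ≡ true
  stage-P× s L = search-P× (end s L) L s

  stage-⊴ : ∀ s L j → j ≤ 2 ^ suc L → stage s L ⊴[ L ] loop (fst s) L (start s L) j
  stage-⊴ s L j j≤ = ⊴-trans (stage s L) (end s L) (loop (fst s) L (start s L) j)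
    (stage-P× s L) (proj₁ (end-Good s L)) (proj₁ (loop-Good (fst s) (start-Good s L) j j≤))
    (le×⇒⊴ (stage s L) (end s L) (search-le× (end s L) L s (proj₁ (end-Good s L))))
    (loop-⊴ (fst s) (start-Good s L) j (2 ^ suc L) j≤ ≤-refl)

  stage-le : ∀ s L → P× (snd s) ≡ true → le (snd (stage s L)) (snd (snd s)) ≡ true
  stage-le s L Ps = le-trans _ _ _ (P×⇒P {stage s L} (stage-P× s L))
    (P×⇒P {start s L} (proj₁ (start-Good s L))) (P×⇒P {snd s} Ps)
    (proj₁ (stage-⊴ s L 0 z≤n))
    (le×⇒le {start s L} {snd s} (subst (λ n → le× (start s L) n ≡ true) (norm-id {snd s} Ps)
      (search-le× (norm (snd s)) L s (norm-P× (snd s)))))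

  -- The string ρ is treated in the round j of its index. Everything after that round alters bits
  -- only at positions up to `L` and otherwise strengthens the answer `r`.
  stage-decides : ∀ s L ρ → length ρ ≡ suc L → Σ ℕ λ m → Σ ℕ λ r →
    P× m ≡ true × Decides m (diagCode (fst s) m) r × ρ ⊑ str r × stage s L ⊴[ L ] r
  stage-decides s L ρ ρ≡ with nthStr-surjective (suc L) ρ ρ≡
  ... | j , j< , refl =
    m , r , proj₁ (redirect-Good {L} {j} j< n good) , decides ,
    (λ i b eq → ≼⇒⊑ {str m} {str r} (le×⇒≼ {r} {m} (proj₁ (proj₂ decides))) i b (redirect-nthStr {L} {j} j< n i b eq)) ,
    stage-⊴ s L (suc j) j<
    where
    n m r : ℕ
    n = loop (fst s) L (start s L) j
    m = redirect L j n
    r = step (fst s) L j n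
    good : Good L n
    good = loop-Good (fst s) (start-Good s L) j (<⇒≤ j<)
    decides : Decides m (diagCode (fst s) m) r
    decides = step-decides {L} {j} j< (fst s) n good

  level-< : ∀ s → level s < level (suc s)
  level-< s = subst (level s <_) (sym (level-suc s)) (search-length (end s (level s)) (level s) s)

  level-mono : ∀ s t → s ≤ t → level s ≤ level t
  level-mono s zero    z≤n = ≤-refl
  level-mono s (suc t) s≤1+t with m≤n⇒m<n∨m≡n s≤1+t
  ... | inj₁ (s≤s s≤t) = ≤-trans (level-mono s t s≤t) (<⇒≤ (level-< t))
  ... | inj₂ refl      = ≤-refl

  n≤level : ∀ n → n ≤ level n
  n≤level zero    = z≤n
  n≤level (suc n) = ≤-trans (s≤s (n≤level n)) (level-< n)

  -- With `level-unique`: the half-open intervals between consecutive levels partition ω, so no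
  -- position is subject to two stages.
  level-cover : ∀ i → Σ ℕ λ s → level s ≤ i × i < level (suc s)
  level-cover zero = 0 , ≤-reflexive level-zero , ≤-trans (s≤s z≤n) (level-< 0)
  level-cover (suc i) with level-cover i
  ... | s , s≤i , i<s with m≤n⇒m<n∨m≡n i<s
  ...   | inj₁ 1+i<s = s , m≤n⇒m≤1+n s≤i , 1+i<s
  ...   | inj₂ 1+i≡s = suc s , ≤-reflexive (sym 1+i≡s) , subst (_< level (suc (suc s))) (sym 1+i≡s) (level-< (suc s))

  level-unique : ∀ s t {i} → level s ≤ i → i < level (suc s) → level t ≤ i → i < level (suc t) → s ≡ t
  level-unique s t s≤i i<s t≤i i<t with <-cmp s t
  ... | tri≈ _ s≡t _ = s≡t
  ... | tri< s<t _ _ = contradiction (≤-trans i<s (≤-trans (level-mono (suc s) t s<t) t≤i)) (<-irrefl refl)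
  ... | tri> _ _ t<s = contradiction (≤-trans i<t (≤-trans (level-mono (suc t) s t<s) s≤i)) (<-irrefl refl)

  -- Position level s is free; stage s fixes the positions strictly between level s and level (suc s).
  InTree : Str → Set
  InTree σ = ∀ s i → i < length σ → level s < i → i < level (suc s) → bitAt σ i ≡ bitAt (str (final s)) i

  -- The first two factors switch the comparison off outside the open interval of stage s. Both sums
  -- may stop at |σ|, since s ≤ level s < i < |σ| for every constraint on σ.
  treeTest : ℕ → ℕ
  treeTest a = ∑< (lengthCode a) λ s → ∑< (lengthCode a) λ i →
    (i ∸ level s) * ((level (suc s) ∸ i) * dist (bitCode (bitAt (decStr a) i)) (bitCode (bitAt (str (final s)) i)))

  treeTestR : Rep₁ treeTest
  treeTestR = fun₁ (∑R (app₁ lengthR x₀) (∑R (app₁ lengthR x₁)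
    (app₂ *R (app₂ ∸R x₀ (app₁ levelR x₁)) (app₂ *R (app₂ ∸R (app₁ levelR (sucR x₁)) x₀)
      (app₂ distR (app₂ bitAtR x₂ x₀) (app₂ bitAtR (app₁ fstR (app₁ finalR x₁)) x₀))))))

  T : Str → Bool
  T σ = isZero (treeTest (encStr σ))

  T-computable : ComputableTree A T
  T-computable = let c , c-computes = fun₁ (app₁ isZeroR (app₁ treeTestR x₀)) in c , λ σ → c-computes (encStr σ)

  T⇒InTree : ∀ σ → T σ ≡ true → InTree σ
  T⇒InTree σ Tσ s i i<σ s<i i<s with
    m*n≡0⇒m≡0∨n≡0 (i ∸ level s)
      (∑<≡0⇒ _ (∑<≡0⇒ _ (isZero⇒ _ Tσ) s
        (in-range (≤-trans (s≤s (n≤level s)) (<⇒≤ (≤-trans (s≤s s<i) i<σ))))) i (in-range i<σ))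
    where
    in-range : ∀ {n} → n < length σ → n < lengthCode (encStr σ)
    in-range = subst (λ τ → _ < length τ) (sym (decStr-encStr σ))
  ... | inj₁ eq = contradiction (m∸n≡0⇒m≤n eq) (<⇒≱ s<i)
  ... | inj₂ eq with m*n≡0⇒m≡0∨n≡0 (level (suc s) ∸ i) eq
  ...   | inj₁ eq′ = contradiction (m∸n≡0⇒m≤n eq′) (<⇒≱ i<s)
  ...   | inj₂ eq′ = trans (cong (λ τ → bitAt τ i) (sym (decStr-encStr σ)))
                       (bitCode-injective _ _ (dist≡0⇒≡ _ _ eq′))

  InTree⇒T : ∀ σ → InTree σ → T σ ≡ true
  InTree⇒T σ σ∈T = ⇒isZero (⇒∑<≡0 (lengthCode (encStr σ)) λ s _ → ⇒∑<≡0 (lengthCode (encStr σ)) λ i i<σ →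
    zero-if s i (subst (λ τ → i < length τ) (decStr-encStr σ) i<σ))
    where
    zero-if : ∀ s i → i < length σ → (i ∸ level s) * ((level (suc s) ∸ i) *
      dist (bitCode (bitAt (decStr (encStr σ)) i)) (bitCode (bitAt (str (final s)) i))) ≡ 0
    zero-if s i i<σ with level s <? i | i <? level (suc s)
    ... | no s≮i | _ rewrite m≤n⇒m∸n≡0 (≮⇒≥ s≮i) = refl
    ... | yes _ | no i≮s rewrite m≤n⇒m∸n≡0 (≮⇒≥ i≮s) = *-zeroʳ (i ∸ level s)
    ... | yes s<i | yes i<s =
      trans (cong (λ z → (i ∸ level s) * ((level (suc s) ∸ i) * z)) (≡⇒dist≡0 (cong bitCode
              (trans (cong (λ τ → bitAt τ i) (decStr-encStr σ)) (σ∈T s i i<σ s<i i<s)))))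
        (trans (cong ((i ∸ level s) *_) (*-zeroʳ (level (suc s) ∸ i))) (*-zeroʳ (i ∸ level s)))

  InTree-∷ʳ : ∀ σ b → InTree σ →
    (∀ s → level s < length σ → length σ < level (suc s) → just b ≡ bitAt (str (final s)) (length σ)) →
    InTree (σ ++ b ∷ [])
  InTree-∷ʳ σ b σ∈T last s i i<σb s<i i<s
    with m<1+n⇒m<n∨m≡n (subst (i <_) (trans (length-++ σ) (+-comm (length σ) 1)) i<σb)
  ... | inj₁ i<σ  = trans (bitAt-++ˡ σ (b ∷ []) i i<σ) (σ∈T s i i<σ s<i i<s)
  ... | inj₂ refl = trans (bitAt-∷ʳ σ b) (last s s<i i<s)

  -- Constraints hold strictly above a level, and the intervals are disjoint, so no stage says
  -- anything about position `level s`.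
  InTree-branch : ∀ s σ b → InTree σ → length σ ≡ level s → InTree (σ ++ b ∷ [])
  InTree-branch s σ b σ∈T σ≡s = InTree-∷ʳ σ b σ∈T λ t t<σ σ<t →
    contradiction (subst (λ t → level t < length σ)
        (level-unique t s (<⇒≤ t<σ) σ<t (≤-reflexive (sym σ≡s)) (subst (_< level (suc s)) (sym σ≡s) (level-< s))) t<σ)
      (<-irrefl (sym σ≡s))

  InTree-extend : ∀ σ → InTree σ → Σ Bool λ b → InTree (σ ++ b ∷ [])
  InTree-extend σ σ∈T with level-cover (length σ)
  ... | s , s≤σ , σ<s with bitAt-< (str (final s)) (length σ) (subst (length σ <_) (level-suc s) σ<s)
  -- Copying the bit of `final s` is admissible throughout the interval, including its free first
  -- position, so no case distinction arises.
  ...   | b , eq = b , InTree-∷ʳ σ b σ∈T λ t t<σ σ<t →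
    subst (λ t → just b ≡ bitAt (str (final t)) (length σ)) (level-unique s t s≤σ σ<s (<⇒≤ t<σ) σ<t) (sym eq)

  InTree-extend* : ∀ k σ → InTree σ → Σ Str λ τ → InTree (σ ++ τ) × length (σ ++ τ) ≡ length σ + k
  InTree-extend* zero σ σ∈T = [] , subst InTree (sym (++-identityʳ σ)) σ∈T , length-++ σ
  InTree-extend* (suc k) σ σ∈T with InTree-extend σ σ∈T
  ... | b , σb∈T with InTree-extend* k (σ ++ b ∷ []) σb∈T
  ...   | τ , στ∈T , eq = b ∷ τ , subst InTree (++-assoc σ (b ∷ []) τ) στ∈T ,
    (begin
      length (σ ++ b ∷ τ)            ≡⟨ cong length (++-assoc σ (b ∷ []) τ) ⟨
      length ((σ ++ b ∷ []) ++ τ)    ≡⟨ eq ⟩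
      length (σ ++ b ∷ []) + k       ≡⟨ cong (_+ k) (length-++ σ) ⟩
      length σ + 1 + k               ≡⟨ +-assoc (length σ) 1 k ⟩
      length σ + suc k ∎)
    where open ≡-Reasoning

  T-perfect : IsPerfectTree T
  T-perfect =
    InTree⇒T [] (λ _ _ ()) ,
    (λ σ τ στ∈T → InTree⇒T σ λ s i i<σ s<i i<s →
      trans (sym (bitAt-++ˡ σ τ i i<σ))
        (T⇒InTree (σ ++ τ) στ∈T s i (≤-trans i<σ (subst (length σ ≤_) (sym (length-++ σ)) (m≤m+n _ _))) s<i i<s)) ,
    -- No branching position has to be searched for: |σ| ≤ level |σ|, so σ is prolonged to length
    -- `level s` with s = |σ| and split there.
    λ σ σ∈T → let s = length σ
                  τ , στ∈T , στ≡ = InTree-extend* (level s ∸ s) σ (T⇒InTree σ σ∈T)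
                  στ≡level = trans στ≡ (m+[n∸m]≡n (n≤level s))
              in ((σ ++ τ) ++ false ∷ []) , ((σ ++ τ) ++ true ∷ []) ,
                 InTree⇒T ((σ ++ τ) ++ false ∷ []) (InTree-branch s (σ ++ τ) false στ∈T στ≡level) ,
                 InTree⇒T ((σ ++ τ) ++ true ∷ []) (InTree-branch s (σ ++ τ) true στ∈T στ≡level) ,
                 (τ ++ false ∷ [] , sym (++-assoc σ τ (false ∷ []))) ,
                 (τ ++ true ∷ [] , sym (++-assoc σ τ (true ∷ []))) ,
                 incomparable (σ ++ τ) (λ ()) , incomparable (σ ++ τ) (λ ())
    where
    incomparable : ∀ σ {b c} → ¬ b ≡ c → ¬ ((σ ++ b ∷ []) ≼ (σ ++ c ∷ []))
    incomparable σ {b} {c} b≢c b≼c = b≢c (just-injective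
      (trans (sym (≼⇒⊑ b≼c (length σ) b (bitAt-∷ʳ σ b))) (bitAt-∷ʳ σ c)))

  path-bit : ∀ {S} → IsPath T S → ∀ s i → level s < i → i < level (suc s) → bitAt (str (final s)) i ≡ just (S i)
  path-bit {S} S∈T s i s<i i<s = trans
    (sym (T⇒InTree (initSeg S (suc i)) (S∈T (suc i)) s i (subst (i <_) (sym (length-initSeg S (suc i))) ≤-refl) s<i i<s))
    (bitAt-initSeg S (suc i) i ≤-refl)

  -- Only stages s ≤ q can have `snd (final s)` equal to q, by `search-≥`; hence the bound `suc q`.
  classTest : ℕ → ℕ → ℕ
  classTest d q = ∏< (suc q) λ s → dist (fst s) d + dist (snd (final s)) q

  classTestR : Rep₂ classTest
  classTestR = fun₂ (∏R (sucR x₁) (app₂ +R (app₂ distR (app₁ fstR x₀) x₁)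
                                           (app₂ distR (app₁ sndR (app₁ finalR x₀)) x₂)))

  𝒞 : ℕ → ℕ → Bool
  𝒞 d q = isZero (classTest d q)

  𝒞-elim : ∀ d q → 𝒞 d q ≡ true → Σ ℕ λ s → fst s ≡ d × snd (final s) ≡ q
  𝒞-elim d q q∈𝒞 with ∏<≡0⇒ (suc q) (isZero⇒ _ q∈𝒞)
  ... | s , _ , eq = s , dist≡0⇒≡ _ _ (m+n≡0⇒m≡0 _ eq) , dist≡0⇒≡ _ _ (m+n≡0⇒n≡0 (dist (fst s) d) eq)

  𝒞-intro : ∀ s → 𝒞 (fst s) (snd (final s)) ≡ true
  𝒞-intro s = ⇒isZero (⇒∏<≡0 (suc (snd (final s))) s (s≤s (search-≥ (end s (level s)) (level s) s))
    (cong₂ _+_ (≡⇒dist≡0 {fst s} refl) (≡⇒dist≡0 {snd (final s)} refl)))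

  final-P : ∀ s → P (snd (final s)) ≡ true
  final-P s = P×⇒P {final s} (stage-P× s (level s))

  final-le : ∀ s n → snd s ≡ n → P× n ≡ true → le (snd (final s)) (snd n) ≡ true
  final-le s .(snd s) refl = stage-le s (level s)

  -- The stage whose number codes d and a product condition over p puts an extension of p into 𝒞 d.
  -- The zeros in the Cohen part are an arbitrary choice of the right length.
  𝒞-dense : ∀ d p → P p ≡ true → Σ ℕ λ q → P q ≡ true × le q p ≡ true × 𝒞 d q ≡ true
  𝒞-dense d p Pp = below (cond σ p) (snd-cond σ p) (cond-P× σ p Pp (length-replicate (length (V p))))
    where
    σ : Str
    σ = replicate (length (V p)) false
    below : ∀ n → snd n ≡ p → P× n ≡ true → Σ ℕ λ q → P q ≡ true × le q p ≡ true × 𝒞 d q ≡ true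
    below n refl Pn = snd (final s) , final-P s , final-le s n (snd-pair d n) Pn ,
      subst (λ d → 𝒞 d (snd (final s)) ≡ true) (fst-pair d n) (𝒞-intro s)
      where
      s : ℕ
      s = pair d n

  𝒞⊆P : ∀ d q → 𝒞 d q ≡ true → P q ≡ true
  𝒞⊆P d q q∈𝒞 = let s , _ , eq = 𝒞-elim d q q∈𝒞 in subst (λ q → P q ≡ true) eq (final-P s)

  𝒞R : Rep₂ (λ d q → b2n (𝒞 d q))
  𝒞R = fun₂ (app₁ isZeroR (app₂ classTestR x₀ x₁))

  𝒞-computable : ComputableDenseClass ℙ A 𝒞
  𝒞-computable = 𝒞R , 𝒞⊆P , 𝒞-dense

-- The diagonal argument

module Diagonalization (A : ℕ → Bool) (ℙ : Forcing) (decidable : OneDecidable (product ℙ) A) where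
  open Forcing ℙ
  open Product ℙ
  open DiagonalCoding A
  open Construction A ℙ decidable
  open TreeAndClass A ℙ decidable

  module _ {S : ℕ → Bool} (S∈T : IsPath T S) {G : ℕ → Bool} (F : ℕ → Set)
           (generic : IsGenericFilter ℙ 𝒞 F) (F-valuation : ValuationOf ℙ F G) where
    X : ℕ → Bool
    X = S ⊕ G

    F-P : ∀ p → F p → P p ≡ true
    F-P = proj₁ (proj₁ generic)

    F-up : ∀ p q → F p → P q ≡ true → le p q ≡ true → F q
    F-up = proj₁ (proj₂ (proj₂ (proj₁ generic)))

    F-directed : ∀ p q → F p → F q → Σ ℕ λ r → F r × le r p ≡ true × le r q ≡ true
    F-directed = proj₂ (proj₂ (proj₂ (proj₁ generic)))

    F-⊏ : ∀ p → F p → V p ⊏ G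
    F-⊏ p p∈F n b eq with F-valuation n
    ... | q , q∈F , eq′ with F-directed p q p∈F q∈F
    ...   | r , r∈F , r≤p , r≤q = just-injective (trans
      (sym (≼⇒⊑ {V q} {V r} (V-mono q r (F-P q q∈F) (F-P r r∈F) r≤q) n (G n) eq′))
      (≼⇒⊑ {V p} {V r} (V-mono p r (F-P p p∈F) (F-P r r∈F) r≤p) n b eq))

    F-meets : ∀ d → Σ ℕ λ q → F q × 𝒞 d q ≡ true
    F-meets d = case (proj₂ (proj₂ generic) d)
      where
      case : (Σ ℕ λ p → F p × 𝒞 d p ≡ true) ⊎
             (Σ ℕ λ p → F p × (∀ q → P q ≡ true → le q p ≡ true → 𝒞 d q ≡ false)) →
             Σ ℕ λ q → F q × 𝒞 d q ≡ true
      case (inj₁ meets) = meets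
      case (inj₂ (p , p∈F , avoids)) =
        let q , Pq , q≤p , q∈𝒞 = 𝒞-dense d p (F-P p p∈F) in
        contradiction (trans (sym q∈𝒞) (avoids q Pq q≤p)) λ ()

    -- The conditions of the product that S and F determine; they take the place of a generic filter
    -- for ℂ × ℙ.
    InFilter : ℕ → Set
    InFilter r = P× r ≡ true × str r ⊏ S × F (snd r)

    InFilter-⊏ : ∀ r → InFilter r → V× r ⊏ X
    InFilter-⊏ r (_ , r⊏S , r∈F) = V×-⊏ r r⊏S (F-⊏ (snd r) r∈F)

    -- Directedness gives a common extension of `snd r` and a long member of F; the Cohen part is
    -- then an initial segment of S of matching length.
    InFilter-extend : ∀ r → InFilter r → ∀ N →
                      Σ ℕ λ q → InFilter q × le× q r ≡ true × N ≤ length (V× q)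
    InFilter-extend r (Pr , r⊏S , r∈F) N with proj₁ (proj₂ generic) N
    ... | p , p∈F , N≤p with F-directed (snd r) p r∈F p∈F
    ...   | q , q∈F , q≤r , q≤p =
      cond σ q ,
      (Pσq , subst (_⊏ S) (sym (str-cond σ q)) (initSeg-⊏ S (length (V q))) , subst F (sym (snd-cond σ q)) q∈F) ,
      cond-le× σ q r (⊏⇒≼-initSeg (str r) S (length (V q)) r⊏S
        (subst (_≤ length (V q)) (sym (P×⇒length {r} Pr)) (V-length (snd r) r∈F q≤r))) q≤r ,
      ≤-trans N≤p (≤-trans (V-length p p∈F q≤p)
        (subst (λ q → length (V q) ≤ length (V× (cond σ _))) (snd-cond σ q) (V×-length (cond σ q) Pσq)))
      where
      σ : Str
      σ = initSeg S (length (V q))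
      Pσq : P× (cond σ q) ≡ true
      Pσq = cond-P× σ q (F-P q q∈F) (length-initSeg S (length (V q)))
      V-length : ∀ p → F p → le q p ≡ true → length (V p) ≤ length (V q)
      V-length p p∈F q≤p = ⊑-length (V p) (V q) (≼⇒⊑ (V-mono p q (F-P p p∈F) (F-P q q∈F) q≤p))

    -- Up to position `level s` the bits of ρ are those of S by assumption. Beyond it they are bits
    -- of `final s`, and there the tree forces S to copy `final s`.
    final-⊏ : ∀ s ρ → initSeg S (suc (level s)) ⊑ ρ →
              (∀ i b → level s < i → bitAt ρ i ≡ just b → bitAt (str (final s)) i ≡ just b) → ρ ⊏ S
    final-⊏ s ρ S⊑ρ ρ⊑final i b eq = case (i <? suc (level s))
      where
      case : Dec (i < suc (level s)) → S i ≡ b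
      case (yes i≤L) = just-injective (trans
        (sym (S⊑ρ i (S i) (bitAt-initSeg S (suc (level s)) i i≤L))) eq)
      case (no i≰L) = just-injective (trans
        (sym (path-bit S∈T s i L<i (subst (i <_) (sym (level-suc s)) (bitAt-just⇒< (str (final s)) i eq′)))) eq′)
        where
        L<i : level s < i
        L<i = ≰⇒> (λ i≤L → i≰L (s≤s i≤L))
        eq′ : bitAt (str (final s)) i ≡ just b
        eq′ = ρ⊑final i b L<i eq

    -- Of all strings treated at stage s, the initial segment of S of length `level s` + 1 is the
    -- one whose answer lies along S.
    final-decided : ∀ s → F (snd (final s)) →
                    Σ ℕ λ m → Σ ℕ λ r → InFilter r × Decides m (diagCode (fst s) m) r
    final-decided s final∈F =
      let m , r , Pm , decides , S⊑r , (final≤r , r⊑final) =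
            stage-decides s (level s) (initSeg S (suc (level s))) (length-initSeg S (suc (level s)))
          Pr = proj₁ decides
      in m , r ,
         (Pr , final-⊏ s (str r) S⊑r r⊑final , F-up (snd (final s)) (snd r) final∈F (P×⇒P {r} Pr) final≤r) ,
         decides

    decided : ∀ d → Σ ℕ λ m → Σ ℕ λ r → InFilter r × Decides m (diagCode d m) r
    decided d =
      let q , q∈F , q∈𝒞 = F-meets d
          s , s≡d , final≡q = 𝒞-elim d q q∈𝒞
      in subst (λ d → Σ ℕ λ m → Σ ℕ λ r → InFilter r × Decides m (diagCode d m) r) s≡d
           (final-decided s (subst F (sym final≡q) q∈F))

    -- h (d , m) is the answer that f₂ gives at the condition m on the diagonal sentence of d, computed from X.
    module _ (h : PR 2) (h-answers : ∀ d m t → Eval A f₂ (m ∷ diagCode d m ∷ []) t → Eval X h (d ∷ m ∷ []) t) where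
      -- The variables `v₂`, `v₁` and `v₀` stand for d, m and the bound on the witnesses of the
      -- computation.
      ψ : BFormula 3
      ψ = graph h v₀ (v₂ ∷ v₁ ∷ []) tzero

      d : ℕ
      d = encForm ⌊ ψ ⌋

      χ : ℕ → BFormula 3
      χ m = instantiate ψ d m

      Sat⇒Eval : ∀ m w m′ d′ → Sat X (χ m) (w ∷ m′ ∷ d′ ∷ []) → Eval X h (d ∷ m ∷ []) 0
      Sat⇒Eval m w m′ d′ (d′≡ , m′≡ , s) = graph-sound X h v₀ (v₂ ∷ v₁ ∷ []) tzero
        (cong₂ (λ a b → a ∷ b ∷ []) (trans d′≡ (⟦numeral⟧ d)) (trans m′≡ (⟦numeral⟧ m))) refl s

      Eval⇒Sat : ∀ m → Eval X h (d ∷ m ∷ []) 0 → Σ ℕ λ w → Sat X (χ m) (w ∷ m ∷ d ∷ [])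
      Eval⇒Sat m ev = let w , s = graph-complete X ev in
        w , sym (⟦numeral⟧ d) , sym (⟦numeral⟧ m) , s v₀ (v₂ ∷ v₁ ∷ []) tzero ≤-refl refl refl

      -- The valuation of `r` may be too short for the matrix to be compared with truth, so a long
      -- extension of `r` along S and F is used instead.
      forced⇒Eval : ∀ m r → InFilter r → Forces D r (∃̇ ∃̇ ∃̇ ⌊ χ m ⌋) [] → Eval X h (d ∷ m ∷ []) 0
      forced⇒Eval m r r∈F@(Pr , _) (d′ , m′ , w , f) =
        let q , q∈F , q≤r , long = InFilter-extend r r∈F (use (χ m) (w ∷ m′ ∷ d′ ∷ []))
            Pq = proj₁ q∈F
        in Sat⇒Eval m w m′ d′ (Forces⇒Sat {p = q} (χ m) {w ∷ m′ ∷ d′ ∷ []} Pq (InFilter-⊏ q q∈F) long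
           (Forces-mono {p = r} {q} (χ m) {w ∷ m′ ∷ d′ ∷ []} Pr Pq q≤r f))

      -- If the sentence were true of X, a sufficiently long extension of `r` along S and F would
      -- force it, against the negation forced by `r`.
      unforced⇒¬Eval : ∀ m r → InFilter r → Forces D r (¬̇ (∃̇ ∃̇ ∃̇ ⌊ χ m ⌋)) [] → ¬ Eval X h (d ∷ m ∷ []) 0
      unforced⇒¬Eval m r r∈F f ev =
        let w , s = Eval⇒Sat m ev
            q , q∈F , q≤r , long = InFilter-extend r r∈F (use (χ m) (w ∷ m ∷ d ∷ []))
            Pq = proj₁ q∈F
        in f q Pq q≤r (d , m , w , Sat⇒Forces {p = q} (χ m) {w ∷ m ∷ d ∷ []} Pq (InFilter-⊏ q q∈F) long s)

      undecided : ∀ m r → InFilter r → ¬ Decides m (diagCode d m) r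
      undecided m r r∈F (Pr , _ , t , ev , t∈2 , forces) = case t∈2 forces′
        where
        forces′ : (t ≡ 1 → Forces D r (∃̇ ∃̇ ∃̇ ⌊ χ m ⌋) []) × (t ≡ 0 → Forces D r (¬̇ (∃̇ ∃̇ ∃̇ ⌊ χ m ⌋)) [])
        forces′ = subst (λ φ → Σ₁ φ → (t ≡ 1 → Forces D r φ []) × (t ≡ 0 → Forces D r (¬̇ φ) []))
          (sentence-diagCode ψ m) forces (s-ex (s-ex (s-ex (s-base (⌊⌋-Δ₀ (χ m))))))
        answers : Eval X h (d ∷ m ∷ []) t
        answers = h-answers d m t ev
        case : t ≡ 1 ⊎ t ≡ 0 →
               (t ≡ 1 → Forces D r (∃̇ ∃̇ ∃̇ ⌊ χ m ⌋) []) × (t ≡ 0 → Forces D r (¬̇ (∃̇ ∃̇ ∃̇ ⌊ χ m ⌋)) []) → ⊥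
        case (inj₁ t≡1) (forces₁ , _) =
          contradiction (trans (sym t≡1) (Eval-det answers (forced⇒Eval m r r∈F (forces₁ t≡1)))) λ ()
        case (inj₂ t≡0) (_ , forces₀) =
          unforced⇒¬Eval m r r∈F (forces₀ t≡0) (subst (Eval X h (d ∷ m ∷ [])) t≡0 answers)

      contradictory : ⊥
      contradictory = let m , r , r∈F , decides = decided d in undecided m r r∈F decides

    not-computable : Rep₂ diagCode → ¬ (A ≤T X)
    not-computable (e , e-computes) (c , c-computes) =
      -- The arguments are (d , m), so the second projection is the condition. Every query to A, in
      -- `f₂` and in the program for `diagCode`, is replaced by a run of `c` on X.
      contradictory (comp f₂ (proj (suc zero) ∷ e ∷ []) [orc≔ c ])
        (λ d m t ev → Eval-relativize c-computes (ev-comp (ev-proj ∷ e-computes d m ∷ []) ev))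

theorem3p7 : (A : ℕ → Bool) (ℙ : Forcing) →
    OneDecidable (product ℙ) A →
    Σ (List Bool → Bool) λ T → ComputableTree A T × IsPerfectTree T ×
    Σ (ℕ → ℕ → Bool) λ 𝒞 → ComputableDenseClass ℙ A 𝒞 ×
    (∀ S → IsPath T S → ∀ G → IsGeneric ℙ 𝒞 G → ¬ (A ≤T (S ⊕ G)))
theorem3p7 A ℙ decidable =
  T , T-computable , T-perfect , 𝒞 , 𝒞-computable ,
  λ { S S∈T G (F , generic , F-valuation) →
    Diagonalization.not-computable A ℙ decidable S∈T F generic F-valuation (DiagonalCoding.diagCodeR A) }
  where open TreeAndClass A ℙ decidable
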